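{- Let $m,n$ be positive integers. Let $0<\lambda_1<\cdots<\lambda_n$ and $0<\mu_1<\cdots<\mu_n$ be real numbers such that $\mu_{i+1}-\mu_i$ is a positive integer for all $1\le i\le n-1$. Then the $n\times n$ matrices $$\left[\frac{1}{(\Gamma(\lambda_i+\mu_j))^m}\right]_{i,j=1}^n\quad\text{and}\quad \left[\beta(\lambda_i,\mu_j)^m\right]_{i,j=1}^n$$ are nonsingular.
   Context: $\Gamma$ is the gamma function and, for $x,y>0$, $\beta(x,y)=\frac{\Gamma(x)\Gamma(y)}{\Gamma(x+y)}$ is the beta function. The powers are entrywise: the $(i,j)$th entries are $1/\Gamma(\lambda_i+\mu_j)^m$ and $(\beta(\lambda_i,\mu_j))^m$, respectively. -}

module Defs where

open import Algebra.Apartness.Bundles using (HeytingField)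
open import Data.Fin.Base using (Fin; zero; suc; toℕ; punchIn)
open import Data.Nat.Base as ℕ using (ℕ; zero; suc; NonZero; _!)
open import Data.Nat.Properties using (_!≢0)
open import Data.Product.Base using (_×_; _,_; proj₁; ∃-syntax; Σ-syntax)
open import Data.Sum.Base using (_⊎_; inj₁; inj₂)
open import Data.Vec.Functional using (Vector)
open import Function.Bundles using (_⇔_; Equivalence)
open import Level using (_⊔_) renaming (suc to lsuc)
open import Relation.Binary.Core using (Rel)
open import Relation.Binary.Structures using (IsStrictPartialOrder)
import Algebra.Apartness.Properties.HeytingCommutativeRing as HeytingProperties
import Algebra.Bundles as Bundles
import Algebra.Definitions.RawSemiring as RawSemiringDefinitions

-- The real numbers, axiomatised up to isomorphism as a Cauchy complete
-- Archimedean ordered field.  No decidability of the order is assumed, so both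
-- the classical reals and the constructive (Cauchy or Dedekind) reals are
-- models.  The apartness _#_ is the constructive form of "distinct";
-- classically it coincides with the negation of _≈_.
record RealNumbers c ℓ₁ ℓ₂ ℓ₃ : Set (lsuc (c ⊔ ℓ₁ ⊔ ℓ₂ ⊔ ℓ₃)) where
  infix 4 _<_ _⟶_
  field
    heytingField : HeytingField c ℓ₁ ℓ₂

  open HeytingField heytingField public

  commutativeRing : Bundles.CommutativeRing c ℓ₁
  commutativeRing = record { isCommutativeRing = isCommutativeRing }

  open RawSemiringDefinitions
    (Bundles.Semiring.rawSemiring
      (Bundles.CommutativeRing.semiring commutativeRing)) public
    using (_^_; sum) renaming (_×_ to _·_)

  ι : ℕ → Carrier
  ι n = n · 1#

  field
    _<_                  : Rel Carrier ℓ₃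
    isStrictPartialOrder : IsStrictPartialOrder _≈_ _<_
    #⇔<⊎>                : ∀ {x y} → x # y ⇔ (x < y ⊎ y < x)
    +-monoˡ-<            : ∀ {x y} z → x < y → x + z < y + z
    *-pos                : ∀ {x y} → 0# < x → 0# < y → 0# < x * y

  _⟶_ : (ℕ → Carrier) → Carrier → Set (c ⊔ ℓ₃)
  s ⟶ L = ∀ ε → 0# < ε →
    ∃[ N ] ∀ n → N ℕ.≤ n → (L - ε < s n) × (s n < L + ε)

  Cauchy : (ℕ → Carrier) → Set (c ⊔ ℓ₃)
  Cauchy s = ∀ ε → 0# < ε →
    ∃[ N ] ∀ m n → N ℕ.≤ m → N ℕ.≤ n → s m < s n + ε

  field
    archimedean : ∀ x → ∃[ n ] x < ι n
    complete    : ∀ s → Cauchy s → ∃[ L ] s ⟶ L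

module RealAnalysis {c ℓ₁ ℓ₂ ℓ₃} (ℝ : RealNumbers c ℓ₁ ℓ₂ ℓ₃) where

  open RealNumbers ℝ public hiding (zero)
  open IsStrictPartialOrder isStrictPartialOrder public
    using (<-respʳ-≈; <-respˡ-≈)
    renaming (irrefl to <-irrefl; trans to <-trans)
  open HeytingProperties heytingCommutativeRing public
    using (1#0; x#0y#0→xy#0)
  open Bundles.CommutativeRing commutativeRing using (ring)
  open import Algebra.Properties.Ring ring using (-1*x≈-x; -‿involutive)

  -- The library's inverse is that of the difference x - 0#, which is ≈ to x.
  1/_⟨_⟩ : ∀ x → x # 0# → Carrier
  1/ x ⟨ x#0 ⟩ = proj₁ (#⇒invertible x#0)

  0<⇒#0 : ∀ {x} → 0# < x → x # 0#
  0<⇒#0 0<x = Equivalence.from #⇔<⊎> (inj₂ 0<x)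

  ^-#0 : ∀ {x} → x # 0# → ∀ n → x ^ n # 0#
  ^-#0 x#0 zero    = 1#0
  ^-#0 x#0 (suc n) = x#0y#0→xy#0 x#0 (^-#0 x#0 n)

  +-pos : ∀ {x y} → 0# < x → 0# < y → 0# < x + y
  +-pos {x} {y} 0<x 0<y =
    <-trans 0<y (<-respˡ-≈ (+-identityˡ y) (+-monoˡ-< y 0<x))

  0<1 : 0# < 1#
  0<1 with Equivalence.to #⇔<⊎> 1#0
  ... | inj₂ 0<1# = 0<1#
  ... | inj₁ 1<0  = <-respʳ-≈ -1*-1≈1 (*-pos 0<-1 0<-1)
    where
    0<-1 : 0# < - 1#
    0<-1 = <-respˡ-≈ (-‿inverseʳ 1#)
             (<-respʳ-≈ (+-identityˡ (- 1#)) (+-monoˡ-< (- 1#) 1<0))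

    -1*-1≈1 : - 1# * - 1# ≈ 1#
    -1*-1≈1 = trans (-1*x≈-x (- 1#)) (-‿involutive 1#)

  0<ι : ∀ n → .{{NonZero n}} → 0# < ι n
  0<ι (suc zero)      = <-respʳ-≈ (sym (+-identityʳ 1#)) 0<1
  0<ι (suc n@(suc _)) = +-pos 0<1 (0<ι n)

  0<x+ι : ∀ {x} → 0# < x → ∀ n → 0# < x + ι n
  0<x+ι {x} 0<x zero = <-respʳ-≈ (sym (+-identityʳ x)) 0<x
  0<x+ι 0<x n@(suc _) = +-pos 0<x (0<ι n)

  expTerm : Carrier → ℕ → Carrier
  expTerm x k = x ^ k * 1/ ι (k !) ⟨ 0<⇒#0 (0<ι (k !) {{k !≢0}}) ⟩

  -- y = eˣ = Σₖ xᵏ / k!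
  IsExp : Carrier → Carrier → Set (c ⊔ ℓ₃)
  IsExp x y = (λ N → sum {N} (λ k → expTerm x (toℕ k))) ⟶ y

  -- y = bˣ = e^(x ln b), where ln b is the number whose exponential is b
  IsPower : Carrier → Carrier → Carrier → Set (c ⊔ ℓ₃)
  IsPower b x y = ∃[ l ] IsExp l b × IsExp (x * l) y

  -- (x)ₖ = x (x + 1) ⋯ (x + k - 1)
  poch : Carrier → ℕ → Carrier
  poch x zero    = 1#
  poch x (suc k) = poch x k * (x + ι k)

  poch-#0 : ∀ {x} → 0# < x → ∀ k → poch x k # 0#
  poch-#0 0<x zero    = 1#0
  poch-#0 0<x (suc k) = x#0y#0→xy#0 (poch-#0 0<x k) (0<⇒#0 (0<x+ι 0<x k))

  -- Γ is the gamma function on the positive reals, by the definition of Euler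
  -- and Gauss:
  --
  --   Γ(x) = lim n! nˣ / (x (x + 1) ⋯ (x + n))   as n → ∞.
  --
  -- Here p n is nˣ; the value p 0 is arbitrary and does not affect the limit.
  IsGamma : (∀ x → 0# < x → Carrier) → Set (c ⊔ ℓ₃)
  IsGamma Γ = ∀ x (0<x : 0# < x) →
    Σ[ p ∈ (ℕ → Carrier) ]
      (∀ n → .{{NonZero n}} → IsPower (ι n) x (p n)) ×
      (λ n → ι (n !) * p n * 1/ poch x (suc n) ⟨ poch-#0 0<x (suc n) ⟩)
        ⟶ Γ x 0<x

  module Beta
    (Γ   : ∀ x → 0# < x → Carrier)
    (Γ#0 : ∀ x (0<x : 0# < x) → Γ x 0<x # 0#)
    where

    β : ∀ x y → 0# < x → 0# < y → Carrier
    β x y 0<x 0<y =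
      Γ x 0<x * Γ y 0<y * 1/ Γ (x + y) (+-pos 0<x 0<y) ⟨ Γ#0 _ _ ⟩

  -- Laplace expansion along the first row
  det : ∀ {n} → Vector (Vector Carrier n) n → Carrier
  det {zero}  A = 1#
  det {suc n} A = sum λ j →
    (- 1#) ^ toℕ j * A zero j * det (λ i k → A (suc i) (punchIn j k))

  Nonsingular : ∀ {n} → Vector (Vector Carrier n) n → Set ℓ₂
  Nonsingular A = det A # 0#

{-# OPTIONS --safe #-}
module Submission where

-- By Γ(x + 1) = x Γ(x), the (i, j) entry 1/Γ(λᵢ + μⱼ)ᵐ is 1/Γ(λᵢ + μₙ)ᵐ times
-- the value at λᵢ of a polynomial (x + a₀)(x + a₁) ⋯ (x + a_{k-1}) with
-- k = m (μₙ - μⱼ), where the sequence a lists μₙ - 1, μₙ - 2, …, each m times.  So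
-- it suffices that det [N_{kⱼ}(xᵢ)] ≠ 0 for the Newton polynomials N_k of a, for
-- x₀ < x₁ < ⋯ with x₀ + a_l > 0 and k decreasing to 0.  Substituting x = x₀ + y
-- makes y₀ = 0 and all a_l positive; expanding the N_k into monomials one node at
-- a time then only adds nonnegative terms, and for monomials the row y₀ = 0 is a
-- unit vector, so that the determinant reduces to a smaller one of the same kind.
--
-- The functional equation and the positivity of Γ come from the limit of Euler
-- and Gauss, whose approximants gₙ satisfy gₙ(x + 1) (x + n + 1) = x n gₙ(x) and
-- increase with n; this needs only e^(x + y) = e^x e^y, e^x ≥ 1 + x for x ≥ 0 and
-- (1 - x) e^x ≤ 1 for x ≥ 0.

open import Defs
open import Data.Fin.Base as Fin using (Fin; toℕ)
open import Data.Nat.Base using (ℕ; suc; NonZero)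
open import Data.Product.Base using (_×_; ∃-syntax; Σ-syntax)
open import Relation.Binary.PropositionalEquality.Core using (_≡_)
open import Algebra.Bundles using (CommutativeRing; RawRing)
open import Algebra.Solver.Ring.AlmostCommutativeRing
  using (fromCommutativeRing; _-Raw-AlmostCommutative⟶_)
open import Data.Empty using (⊥)
open import Data.Fin.Base using (zero; suc; fromℕ; fromℕ<; inject₁; punchIn; punchOut)
open import Data.Fin.Induction using (<-weakInduction; >-weakInduction)
open import Data.Fin.Relation.Unary.Top using (view; ‵fromℕ; ‵inject₁)
open import Data.Integer.Base as ℤ using (ℤ; -[1+_])
open import Data.Maybe.Base using (Maybe; just; nothing)
open import Data.Nat.Base as ℕ using (zero; _!)
open import Data.Nat.DivMod using (_/_; m<n⇒m/n≡0; m/n≡1+[m∸n]/n)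
open import Data.Product.Base using (_,_; proj₁; proj₂)
open import Data.Sum.Base using (_⊎_; inj₁; inj₂; [_,_]′)
open import Data.Vec.Functional using (Vector; updateAt)
open import Data.Vec.Functional.Properties using (updateAt-updates; updateAt-minimal)
open import Function.Base using (id; _∘_; _$_; const)
open import Function.Bundles using (Equivalence)
open import Relation.Binary.PropositionalEquality.Core as ≡ using (_≢_)
open import Relation.Nullary.Decidable.Core using (yes; no)
open import Relation.Nullary.Negation.Core using (¬_; contradiction)
import Algebra.Apartness.Properties.HeytingCommutativeRing as HeytingProperties
import Algebra.Properties.AbelianGroup
import Algebra.Properties.CommutativeMonoid.Sum
import Algebra.Properties.CommutativeSemiring.Exp
import Algebra.Properties.Ring
import Algebra.Properties.Semiring.Mult
import Algebra.Properties.Semiring.Mult.TCOptimised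
import Algebra.Properties.Semiring.Sum
import Algebra.Solver.Ring
import Data.Fin.Properties as Fin
import Data.Integer.Properties as ℤ
import Data.Nat.Properties as ℕ
import Relation.Binary.Reasoning.Setoid

-- Apartness of a determinant from zero is stronger than a refutation of equality, and the order is
-- not decidable; so the determinant is given a sign. Up to the sign that reverses the columns it is
-- built from 1 by multiplying with positive factors and adding nonnegative terms, and strict
-- positivity survives both. The arguments are compared with λᵢ + μₙ because only an upward shift
-- turns 1/Γ into a polynomial times 1/Γ of the shifted argument, and a common target makes that
-- last factor a row factor. The shifts of all columns end at the same place, so their Pochhammer
-- products, read from the top, start with the same factors; this nesting is what makes them Newton
-- polynomials of one sequence. An m-th power only repeats each factor m times and stays in the
-- family. The beta matrix differs from the reciprocal gamma matrix by the row factors Γ(λᵢ)ᵐ and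
-- the column factors Γ(μⱼ)ᵐ. Γ is known only as a limit, and its powers nˣ only through a relation
-- between numbers and their exponentials. Hence the exponential is first built as a function, by
-- completeness.

-- Ordered field arithmetic without a decidable order

module OrderedField {c ℓ₁ ℓ₂ ℓ₃} (ℝ : RealNumbers c ℓ₁ ℓ₂ ℓ₃) where

  open RealAnalysis ℝ public
  open CommutativeRing commutativeRing public
    using (commutativeSemiring; semiring; ring; +-abelianGroup; *-commutativeMonoid)
  open Algebra.Properties.Ring ring public
    using (-‿distribˡ-*; -‿distribʳ-*; -0#≈0#; -‿involutive)
  open Algebra.Properties.AbelianGroup +-abelianGroup public
    using () renaming (⁻¹-∙-comm to -‿+-comm; x∙y⁻¹≈ε⇒x≈y to x-y≈0⇒x≈y)
  open Algebra.Properties.CommutativeSemiring.Exp commutativeSemiring public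
    using (^-congˡ; ^-homo-*; ^-distrib-*)
  open HeytingProperties heytingCommutativeRing public using (x-0≈x; #-congʳ)
  module Mult = Algebra.Properties.Semiring.Mult semiring
  module Mult′ = Algebra.Properties.Semiring.Mult.TCOptimised semiring
  module Sum = Algebra.Properties.Semiring.Sum semiring
  module ≈-Reasoning = Relation.Binary.Reasoning.Setoid setoid

  private
    _×′_ : ℕ → Carrier → Carrier
    _×′_ = Mult′._×_

    -- Integer coefficients let the ring solver decide when coefficients cancel; equality of reals
    -- is not decidable. With the optimised multiple `×′` the coefficients 0 and 1 compute to `0#`
    -- and `1#`.
    ⟦_⟧ℤ : ℤ → Carrier
    ⟦ ℤ.+ n ⟧ℤ    = n ×′ 1#
    ⟦ -[1+ n ] ⟧ℤ = - (suc n ×′ 1#)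

    ⟦⟧-neg : ∀ i → ⟦ ℤ.- i ⟧ℤ ≈ - ⟦ i ⟧ℤ
    ⟦⟧-neg (ℤ.+ zero)  = sym -0#≈0#
    ⟦⟧-neg (ℤ.+ suc n) = refl
    ⟦⟧-neg -[1+ n ]    = sym (-‿involutive _)

    cancel-1+ : ∀ x y → x - y ≈ (1# + x) - (1# + y)
    cancel-1+ x y = begin
      x - y                        ≈⟨ +-congʳ (+-identityʳ x) ⟨
      x + 0# - y                   ≈⟨ +-congʳ (+-congˡ (-‿inverseʳ 1#)) ⟨
      x + (1# - 1#) - y            ≈⟨ +-congʳ (+-assoc x 1# (- 1#)) ⟨
      x + 1# - 1# - y              ≈⟨ +-congʳ (+-congʳ (+-comm x 1#)) ⟩
      1# + x - 1# - y              ≈⟨ +-assoc _ _ _ ⟩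
      1# + x + (- 1# - y)          ≈⟨ +-congˡ (-‿+-comm 1# y) ⟩
      (1# + x) - (1# + y)          ∎
      where open ≈-Reasoning

    ⟦⟧-⊖ : ∀ m n → ⟦ m ℤ.⊖ n ⟧ℤ ≈ m ×′ 1# - n ×′ 1#
    ⟦⟧-⊖ zero    zero    = sym (-‿inverseʳ 0#)
    ⟦⟧-⊖ zero    (suc n) = sym (+-identityˡ _)
    ⟦⟧-⊖ (suc m) zero    = sym (trans (+-congˡ -0#≈0#) (+-identityʳ _))
    ⟦⟧-⊖ (suc m) (suc n) rewrite ℤ.[1+m]⊖[1+n]≡m⊖n m n = begin
      ⟦ m ℤ.⊖ n ⟧ℤ                       ≈⟨ ⟦⟧-⊖ m n ⟩
      m ×′ 1# - n ×′ 1#                  ≈⟨ cancel-1+ _ _ ⟩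
      (1# + m ×′ 1#) - (1# + n ×′ 1#)    ≈⟨ +-cong (Mult′.1+× m 1#) (-‿cong (Mult′.1+× n 1#)) ⟨
      suc m ×′ 1# - suc n ×′ 1#          ∎
      where open ≈-Reasoning

    ⟦⟧-+ : ∀ i j → ⟦ i ℤ.+ j ⟧ℤ ≈ ⟦ i ⟧ℤ + ⟦ j ⟧ℤ
    ⟦⟧-+ (ℤ.+ m)  (ℤ.+ n)  = Mult′.×-homo-+ 1# m n
    ⟦⟧-+ (ℤ.+ m)  -[1+ n ] = ⟦⟧-⊖ m (suc n)
    ⟦⟧-+ -[1+ m ] (ℤ.+ n)  = trans (⟦⟧-⊖ n (suc m)) (+-comm _ _)
    ⟦⟧-+ -[1+ m ] -[1+ n ] = begin
      - (suc (suc (m ℕ.+ n)) ×′ 1#)        ≡⟨ ≡.cong (λ k → - (suc k ×′ 1#)) (ℕ.+-suc m n) ⟨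
      - ((suc m ℕ.+ suc n) ×′ 1#)          ≈⟨ -‿cong (Mult′.×-homo-+ 1# (suc m) (suc n)) ⟩
      - (suc m ×′ 1# + suc n ×′ 1#)        ≈⟨ -‿+-comm _ _ ⟨
      - (suc m ×′ 1#) - (suc n ×′ 1#)      ∎
      where open ≈-Reasoning

    ⟦⟧-+* : ∀ m j → ⟦ ℤ.+ m ℤ.* j ⟧ℤ ≈ ⟦ ℤ.+ m ⟧ℤ * ⟦ j ⟧ℤ
    ⟦⟧-+* m (ℤ.+ n)  rewrite ≡.sym (ℤ.pos-* m n) = Mult′.×1-homo-* m n
    ⟦⟧-+* m -[1+ n ] rewrite ≡.sym (ℤ.neg-distribʳ-* (ℤ.+ m) (ℤ.+ suc n))
                           | ≡.sym (ℤ.pos-* m (suc n)) =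
      trans (⟦⟧-neg (ℤ.+ (m ℕ.* suc n)))
        (trans (-‿cong (Mult′.×1-homo-* m (suc n))) (-‿distribʳ-* _ _))

    ⟦⟧-* : ∀ i j → ⟦ i ℤ.* j ⟧ℤ ≈ ⟦ i ⟧ℤ * ⟦ j ⟧ℤ
    ⟦⟧-* (ℤ.+ m)  j = ⟦⟧-+* m j
    ⟦⟧-* -[1+ m ] j rewrite ≡.sym (ℤ.neg-distribˡ-* (ℤ.+ suc m) j) =
      trans (⟦⟧-neg (ℤ.+ suc m ℤ.* j))
        (trans (-‿cong (⟦⟧-+* (suc m) j)) (-‿distribˡ-* _ _))

    ℤ-ring : RawRing _ _
    ℤ-ring = record
      { Carrier = ℤ ; _≈_ = _≡_ ; _+_ = ℤ._+_ ; _*_ = ℤ._*_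
      ; -_ = ℤ.-_ ; 0# = ℤ.0ℤ ; 1# = ℤ.1ℤ }

    ℤ-homomorphism : ℤ-ring -Raw-AlmostCommutative⟶ fromCommutativeRing commutativeRing
    ℤ-homomorphism = record
      { ⟦_⟧ = ⟦_⟧ℤ ; +-homo = ⟦⟧-+ ; *-homo = ⟦⟧-*
      ; -‿homo = ⟦⟧-neg ; 0-homo = refl ; 1-homo = refl }

    _≟ℤ_ : ∀ i j → Maybe (⟦ i ⟧ℤ ≈ ⟦ j ⟧ℤ)
    i ≟ℤ j with i ℤ.≟ j
    ... | yes ≡.refl = just refl
    ... | no  _      = nothing

  open Algebra.Solver.Ring ℤ-ring (fromCommutativeRing commutativeRing)
    ℤ-homomorphism _≟ℤ_ public
    using (solve; con; _:=_; _:+_; _:*_; _:-_; :-_; Polynomial)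

  :0 :1 : ∀ {n} → Polynomial n
  :0 = con (ℤ.+ 0)
  :1 = con (ℤ.+ 1)

  infix 4 _≤_
  -- As a negation, a weak inequality is proved by refuting the strict converse; it does not split
  -- into `<` or `≈`.
  _≤_ : Carrier → Carrier → Set ℓ₃
  x ≤ y = ¬ (y < x)

  private variable x y z w : Carrier

  -- The substitute for trichotomy: `z` is apart from `x` or from `y`, and where it falls outside
  -- the interval, transitivity still gives one of the alternatives.
  <-cotrans : x < y → ∀ z → (x < z) ⊎ (z < y)
  <-cotrans x<y z with #-cotrans (Equivalence.from #⇔<⊎> (inj₁ x<y)) z
  ... | inj₁ x#z with Equivalence.to #⇔<⊎> x#z
  ...   | inj₁ x<z = inj₁ x<z
  ...   | inj₂ z<x = inj₂ (<-trans z<x x<y)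
  <-cotrans x<y z | inj₂ z#y with Equivalence.to #⇔<⊎> z#y
  ...   | inj₁ z<y = inj₂ z<y
  ...   | inj₂ y<z = inj₁ (<-trans x<y y<z)

  #⇒<⊎> : x # y → (x < y) ⊎ (y < x)
  #⇒<⊎> = Equivalence.to #⇔<⊎>

  <⇒≤ : x < y → x ≤ y
  <⇒≤ x<y y<x = <-irrefl refl (<-trans x<y y<x)

  ≤-reflexive : x ≈ y → x ≤ y
  ≤-reflexive x≈y y<x = <-irrefl (sym x≈y) y<x

  ≤-<-trans : x ≤ y → y < z → x < z
  ≤-<-trans {x} x≤y y<z with <-cotrans y<z x
  ... | inj₁ y<x = contradiction y<x x≤y
  ... | inj₂ x<z = x<z

  <-≤-trans : x < y → y ≤ z → x < z
  <-≤-trans {z = z} x<y y≤z with <-cotrans x<y z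
  ... | inj₁ x<z = x<z
  ... | inj₂ z<y = contradiction z<y y≤z

  ≤-trans : x ≤ y → y ≤ z → x ≤ z
  ≤-trans x≤y y≤z z<x = y≤z (<-≤-trans z<x x≤y)

  ≤-antisym : x ≤ y → y ≤ x → x ≈ y
  ≤-antisym x≤y y≤x =
    proj₁ (tight _ _) λ x#y → [ y≤x , x≤y ]′ (#⇒<⊎> x#y)

  <-resp : x ≈ z → y ≈ w → x < y → z < w
  <-resp x≈z y≈w x<y = <-respʳ-≈ y≈w (<-respˡ-≈ x≈z x<y)

  ≤-resp : x ≈ z → y ≈ w → x ≤ y → z ≤ w
  ≤-resp x≈z y≈w x≤y w<z = x≤y (<-resp (sym y≈w) (sym x≈z) w<z)

  -- Linear arithmetic is done by moving everything to one side: x < y is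
  -- 0 < y - x, and the ring solver identifies y - x with a positive expression.
  <⇒0<- : x < y → 0# < y - x
  <⇒0<- {x} {y} x<y = <-respˡ-≈ (-‿inverseʳ x) (+-monoˡ-< (- x) x<y)

  0<-⇒< : y - x ≈ z → 0# < z → x < y
  0<-⇒< {y} {x} y-x≈z 0<z =
    <-resp (+-identityˡ x) (solve 2 (λ y x → y :- x :+ x := y) refl y x)
      (+-monoˡ-< x (<-respʳ-≈ (sym y-x≈z) 0<z))

  ≤⇒0≤- : x ≤ y → 0# ≤ y - x
  ≤⇒0≤- {x} {y} x≤y y-x<0 =
    x≤y (0<-⇒< (solve 2 (λ x y → x :- y := :0 :- (y :- x)) refl x y) (<⇒0<- y-x<0))

  0≤-⇒≤ : y - x ≈ z → 0# ≤ z → x ≤ y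
  0≤-⇒≤ {y} {x} y-x≈z 0≤z y<x = 0≤z
    (0<-⇒< (trans (+-congˡ (-‿cong (sym y-x≈z)))
              (solve 2 (λ x y → :0 :- (y :- x) := x :- y) refl x y)) (<⇒0<- y<x))

  +-nonneg : 0# ≤ x → 0# ≤ y → 0# ≤ x + y
  +-nonneg {x} {y} 0≤x 0≤y x+y<0 = 0≤x (<-≤-trans x<-y -y≤0)
    where
    x<-y : x < - y
    x<-y = 0<-⇒< (solve 2 (λ x y → :- y :- x := :0 :- (x :+ y)) refl x y) (<⇒0<- x+y<0)
    -y≤0 : - y ≤ 0#
    -y≤0 = 0≤-⇒≤ (solve 1 (λ y → :0 :- (:- y) := y) refl y) 0≤y

  +-pos-nonneg : 0# < x → 0# ≤ y → 0# < x + y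
  +-pos-nonneg {x} {y} 0<x 0≤y =
    <-≤-trans 0<x (0≤-⇒≤ (solve 2 (λ x y → x :+ y :- x := y) refl x y) 0≤y)

  +-mono-≤ : x ≤ y → z ≤ w → x + z ≤ y + w
  +-mono-≤ {x} {y} {z} {w} x≤y z≤w = 0≤-⇒≤
    (solve 4 (λ x y z w → y :+ w :- (x :+ z) := (y :- x) :+ (w :- z)) refl x y z w)
    (+-nonneg (≤⇒0≤- x≤y) (≤⇒0≤- z≤w))

  -- Apartness from zero is invertibility, and if `i` inverts the product then `y * i` inverts `x`.
  -- This is how a factor obtains a sign although signs are not decidable.
  xy#0⇒x#0 : x * y # 0# → x # 0#
  xy#0⇒x#0 {x} {y} xy#0 with #⇒invertible xy#0
  ... | i , i*xy≈1 , xy*i≈1 = invertible⇒# (y * i , yi*x≈1 , trans (*-comm _ _) yi*x≈1)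
    where
    yi*x≈1 : y * i * (x - 0#) ≈ 1#
    yi*x≈1 = trans (solve 3 (λ x y i → y :* i :* (x :- :0) := i :* (x :* y :- :0)) refl x y i)
        i*xy≈1

  <0⇒0<- : x < 0# → 0# < - x
  <0⇒0<- {x} x<0 = <-respʳ-≈ (solve 1 (λ x → :0 :- x := :- x) refl x) (<⇒0<- x<0)

  private
    <0⇒#0 : x < 0# → x # 0#
    <0⇒#0 x<0 = Equivalence.from #⇔<⊎> (inj₁ x<0)

  -- A negative product is apart from zero, hence so are both factors; each then has a sign, and the
  -- signs contradict the product.
  *-nonneg : 0# ≤ x → 0# ≤ y → 0# ≤ x * y
  *-nonneg {x} {y} 0≤x 0≤y xy<0 =
    [ 0≤x , (λ 0<x → [ 0≤y , (λ 0<y → <⇒≤ (*-pos 0<x 0<y) xy<0) ]′ y-sign) ]′ x-sign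
    where
    x-sign : (x < 0#) ⊎ (0# < x)
    x-sign = #⇒<⊎> (xy#0⇒x#0 (<0⇒#0 xy<0))
    y-sign : (y < 0#) ⊎ (0# < y)
    y-sign = #⇒<⊎> (xy#0⇒x#0 (<0⇒#0 (<-respˡ-≈ (*-comm x y) xy<0)))

  x*x-nonneg : ∀ x → 0# ≤ x * x
  x*x-nonneg x xx<0 = [ x≮0 , (λ 0<x → <⇒≤ (*-pos 0<x 0<x) xx<0) ]′ (#⇒<⊎> (xy#0⇒x#0 (<0⇒#0 xx<0)))
    where
    x≮0 : ¬ (x < 0#)
    x≮0 x<0 = <⇒≤ (*-pos (<0⇒0<- x<0) (<0⇒0<- x<0))
      (<-respˡ-≈ (solve 1 (λ x → x :* x := (:- x) :* (:- x)) refl x) xx<0)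

  pos-cancelˡ : 0# < x → 0# < x * y → 0# < y
  pos-cancelˡ {x} {y} 0<x 0<xy = [ (λ y<0 → contradiction 0<xy (xy≤0 y<0)) , id ]′
    (#⇒<⊎> (xy#0⇒x#0 (0<⇒#0 (<-respʳ-≈ (*-comm x y) 0<xy))))
    where
    xy≤0 : y < 0# → x * y ≤ 0#
    xy≤0 y<0 = <⇒≤ (0<-⇒<
      (solve 2 (λ x y → :0 :- x :* y := x :* (:- y)) refl x y) (*-pos 0<x (<0⇒0<- y<0)))

  nonneg-cancelˡ : 0# < x → 0# ≤ x * y → 0# ≤ y
  nonneg-cancelˡ {x} {y} 0<x 0≤xy y<0 = 0≤xy (0<-⇒<
    (solve 2 (λ x y → :0 :- x :* y := x :* (:- y)) refl x y) (*-pos 0<x (<0⇒0<- y<0)))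

  *-monoˡ-< : 0# < x → y < z → x * y < x * z
  *-monoˡ-< {x} {y} {z} 0<x y<z = 0<-⇒<
    (solve 3 (λ x y z → x :* z :- x :* y := x :* (z :- y)) refl x y z) (*-pos 0<x (<⇒0<- y<z))

  *-cancelˡ-< : 0# < x → x * y < x * z → y < z
  *-cancelˡ-< {x} {y} {z} 0<x xy<xz = 0<-⇒< refl (pos-cancelˡ 0<x (<-respʳ-≈
    (solve 3 (λ x y z → x :* z :- x :* y := x :* (z :- y)) refl x y z) (<⇒0<- xy<xz)))

  *-cancelˡ-≤ : 0# < x → x * y ≤ x * z → y ≤ z
  *-cancelˡ-≤ 0<x xy≤xz z<y = xy≤xz (*-monoˡ-< 0<x z<y)

  *-cancelˡ : 0# < x → x * y ≈ x * z → y ≈ z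
  *-cancelˡ 0<x xy≈xz = ≤-antisym (*-cancelˡ-≤ 0<x (≤-reflexive xy≈xz))
                                  (*-cancelˡ-≤ 0<x (≤-reflexive (sym xy≈xz)))

  *-mono-≤ : 0# ≤ x → x ≤ y → 0# ≤ z → z ≤ w → x * z ≤ y * w
  *-mono-≤ {x} {y} {z} {w} 0≤x x≤y 0≤z z≤w = 0≤-⇒≤
    (solve 4 (λ x y z w → y :* w :- x :* z := (y :- x) :* w :+ x :* (w :- z)) refl x y z w)
    (+-nonneg (*-nonneg (≤⇒0≤- x≤y) (≤-trans 0≤z z≤w)) (*-nonneg 0≤x (≤⇒0≤- z≤w)))

  1/-inverseˡ : ∀ {x} (x#0 : x # 0#) → 1/ x ⟨ x#0 ⟩ * x ≈ 1#
  1/-inverseˡ {x} x#0 = trans (*-congˡ (sym (x-0≈x x))) (proj₁ (proj₂ (#⇒invertible x#0)))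

  1/-inverseʳ : ∀ {x} (x#0 : x # 0#) → x * 1/ x ⟨ x#0 ⟩ ≈ 1#
  1/-inverseʳ x#0 = trans (*-comm _ _) (1/-inverseˡ x#0)

  1/-unique : ∀ {x y} (x#0 : x # 0#) → x * y ≈ 1# → y ≈ 1/ x ⟨ x#0 ⟩
  1/-unique {x} {y} x#0 xy≈1 = begin
    y             ≈⟨ *-identityˡ y ⟨
    1# * y        ≈⟨ *-congʳ (1/-inverseˡ x#0) ⟨
    i * x * y     ≈⟨ *-assoc i x y ⟩
    i * (x * y)   ≈⟨ *-congˡ xy≈1 ⟩
    i * 1#        ≈⟨ *-identityʳ i ⟩
    i             ∎
    where
    open ≈-Reasoning
    i = 1/ x ⟨ x#0 ⟩

  1/-pos : ∀ {x} (x#0 : x # 0#) → 0# < x → 0# < 1/ x ⟨ x#0 ⟩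
  1/-pos x#0 0<x = pos-cancelˡ 0<x (<-respʳ-≈ (sym (1/-inverseʳ x#0)) 0<1)

  abstract
    <-half : 0# < x → ∃[ y ] 0# < y × y + y ≈ x
    <-half {x} 0<x = h * x , *-pos (1/-pos 2#0 0<2) 0<x , (begin
      h * x + h * x      ≈⟨ solve 2 (λ h x → h :* x :+ h :* x := h :* (:1 :+ :1) :* x) refl h x ⟩
      h * (1# + 1#) * x  ≈⟨ *-congʳ (1/-inverseˡ 2#0) ⟩
      1# * x             ≈⟨ *-identityˡ x ⟩
      x                  ∎)
      where
      open ≈-Reasoning
      0<2 : 0# < 1# + 1#
      0<2 = +-pos 0<1 0<1
      2#0 : 1# + 1# # 0#
      2#0 = 0<⇒#0 0<2
      h : Carrier
      h = 1/ 1# + 1# ⟨ 2#0 ⟩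

  0≤1 : 0# ≤ 1#
  0≤1 = <⇒≤ 0<1

  ι-+ : ∀ m n → ι (m ℕ.+ n) ≈ ι m + ι n
  ι-+ = Mult.×-homo-+ 1#

  ι-* : ∀ m n → ι (m ℕ.* n) ≈ ι m * ι n
  ι-* = Mult.×1-homo-*

  0≤ι : ∀ n → 0# ≤ ι n
  0≤ι zero    = ≤-reflexive refl
  0≤ι (suc n) = +-nonneg 0≤1 (0≤ι n)

  0<ι-suc : ∀ n → 0# < ι (suc n)
  0<ι-suc n = 0<ι (suc n)

  ι-mono-≤ : ∀ {m n} → m ℕ.≤ n → ι m ≤ ι n
  ι-mono-≤ {n = n} ℕ.z≤n  = 0≤ι n
  ι-mono-≤ (ℕ.s≤s m≤n)    = +-mono-≤ (≤-reflexive refl) (ι-mono-≤ m≤n)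

  ι-mono-< : ∀ {m n} → m ℕ.< n → ι m < ι n
  ι-mono-< {m} m<n = <-≤-trans
    (0<-⇒< (solve 1 (λ m → :1 :+ m :- m := :1) refl (ι m)) 0<1) (ι-mono-≤ m<n)

  ^-pos : 0# < x → ∀ n → 0# < x ^ n
  ^-pos 0<x zero    = 0<1
  ^-pos 0<x (suc n) = *-pos 0<x (^-pos 0<x n)

  ^-nonneg : 0# ≤ x → ∀ n → 0# ≤ x ^ n
  ^-nonneg 0≤x zero    = 0≤1
  ^-nonneg 0≤x (suc n) = *-nonneg 0≤x (^-nonneg 0≤x n)

  1^ : ∀ n → 1# ^ n ≈ 1#
  1^ zero    = refl
  1^ (suc n) = trans (*-identityˡ _) (1^ n)

-- Two-sided bounds and limits of sequences

module Limits {c ℓ₁ ℓ₂ ℓ₃} (ℝ : RealNumbers c ℓ₁ ℓ₂ ℓ₃) where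

  open OrderedField ℝ public

  private variable
    x y d e : Carrier
    s t : ℕ → Carrier
    L M : Carrier

  infix 4 ∣_∣<_ ∣_∣≤_
  -- A bound on an absolute value is a pair of inequalities, since the absolute value itself cannot
  -- be defined by cases on the sign.
  ∣_∣<_ ∣_∣≤_ : Carrier → Carrier → Set ℓ₃
  ∣ x ∣< e = (- e < x) × (x < e)
  ∣ x ∣≤ e = (- e ≤ x) × (x ≤ e)

  ∣∣≤-nonneg : ∣ x ∣≤ e → 0# ≤ e
  ∣∣≤-nonneg {x} {e} (-e≤x , x≤e) = nonneg-cancelˡ (+-pos 0<1 0<1)
    (≤-resp refl (solve 2 (λ x e → (e :- x) :+ (x :- (:- e)) := (:1 :+ :1) :* e) refl x e)
      (+-nonneg (≤⇒0≤- x≤e) (≤⇒0≤- -e≤x)))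

  ∣∣<-resp : x ≈ y → d ≈ e → ∣ x ∣< d → ∣ y ∣< e
  ∣∣<-resp x≈y d≈e (l , u) = <-resp (-‿cong d≈e) x≈y l , <-resp x≈y d≈e u

  ∣∣≤-resp : x ≈ y → d ≈ e → ∣ x ∣≤ d → ∣ y ∣≤ e
  ∣∣≤-resp x≈y d≈e (l , u) = ≤-resp (-‿cong d≈e) x≈y l , ≤-resp x≈y d≈e u

  neg-mono-≤ : x ≤ y → - y ≤ - x
  neg-mono-≤ {x} {y} x≤y =
    0≤-⇒≤ (solve 2 (λ x y → :- x :- (:- y) := y :- x) refl x y) (≤⇒0≤- x≤y)

  ∣∣≤⇒< : ∣ x ∣≤ d → d < e → ∣ x ∣< e
  ∣∣≤⇒< {x} {d} {e} (l , u) d<e =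
    <-≤-trans (0<-⇒< (solve 2 (λ d e → :- d :- (:- e) := e :- d) refl d e) (<⇒0<- d<e)) l ,
    ≤-<-trans u d<e

  ∣∣<⇒≤ : ∣ x ∣< e → ∣ x ∣≤ e
  ∣∣<⇒≤ (l , u) = <⇒≤ l , <⇒≤ u

  ∣∣≤-weaken : ∣ x ∣≤ d → d ≤ e → ∣ x ∣≤ e
  ∣∣≤-weaken (l , u) d≤e = ≤-trans (neg-mono-≤ d≤e) l , ≤-trans u d≤e

  nonneg⇒∣∣≤ : 0# ≤ x → ∣ x ∣≤ x
  nonneg⇒∣∣≤ {x} 0≤x = ≤-trans (≤-resp refl -0#≈0# (neg-mono-≤ 0≤x)) 0≤x , ≤-reflexive refl

  ∣∣<-+ : ∣ x ∣< d → ∣ y ∣< e → ∣ x + y ∣< d + e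
  ∣∣<-+ {x} {d} {y} {e} (l , u) (l′ , u′) =
    0<-⇒< (solve 4 (λ x y d e → x :+ y :- (:- (d :+ e)) := (x :- (:- d)) :+ (y :- (:- e))) refl x y
        d e)
      (+-pos (<⇒0<- l) (<⇒0<- l′)) ,
    0<-⇒< (solve 4 (λ x y d e → d :+ e :- (x :+ y) := (d :- x) :+ (e :- y)) refl x y d e)
      (+-pos (<⇒0<- u) (<⇒0<- u′))

  ∣∣≤-+ : ∣ x ∣≤ d → ∣ y ∣≤ e → ∣ x + y ∣≤ d + e
  ∣∣≤-+ {x} {d} {y} {e} (l , u) (l′ , u′) =
    ≤-resp (-‿+-comm d e) refl (+-mono-≤ l l′) , +-mono-≤ u u′

  -- No split on signs: twice d e + x y and twice d e - x y are sums of products of the positive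
  -- gaps d ± x and e ± y.
  ∣∣<-* : ∣ x ∣< d → ∣ y ∣< e → ∣ x * y ∣< d * e
  ∣∣<-* {x} {d} {y} {e} (l , u) (l′ , u′) =
    0<-⇒< refl (pos-cancelˡ (+-pos 0<1 0<1) (<-respʳ-≈
      (solve 4 (λ x y d e → (d :- x) :* (e :- y) :+ (x :- (:- d)) :* (y :- (:- e))
                          := (:1 :+ :1) :* (x :* y :- (:- (d :* e)))) refl x y d e)
      (+-pos (*-pos (<⇒0<- u) (<⇒0<- u′)) (*-pos (<⇒0<- l) (<⇒0<- l′))))) ,
    0<-⇒< refl (pos-cancelˡ (+-pos 0<1 0<1) (<-respʳ-≈
      (solve 4 (λ x y d e → (d :- x) :* (y :- (:- e)) :+ (x :- (:- d)) :* (e :- y)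
                          := (:1 :+ :1) :* (d :* e :- x :* y)) refl x y d e)
      (+-pos (*-pos (<⇒0<- u) (<⇒0<- l′)) (*-pos (<⇒0<- l) (<⇒0<- u′)))))

  ∣∣≤-* : ∣ x ∣≤ d → ∣ y ∣≤ e → ∣ x * y ∣≤ d * e
  ∣∣≤-* {x} {d} {y} {e} (l , u) (l′ , u′) =
    0≤-⇒≤ refl (nonneg-cancelˡ (+-pos 0<1 0<1) (≤-resp refl
      (solve 4 (λ x y d e → (d :- x) :* (e :- y) :+ (x :- (:- d)) :* (y :- (:- e))
                          := (:1 :+ :1) :* (x :* y :- (:- (d :* e)))) refl x y d e)
      (+-nonneg (*-nonneg (≤⇒0≤- u) (≤⇒0≤- u′)) (*-nonneg (≤⇒0≤- l) (≤⇒0≤- l′))))) ,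
    0≤-⇒≤ refl (nonneg-cancelˡ (+-pos 0<1 0<1) (≤-resp refl
      (solve 4 (λ x y d e → (d :- x) :* (y :- (:- e)) :+ (x :- (:- d)) :* (e :- y)
                          := (:1 :+ :1) :* (d :* e :- x :* y)) refl x y d e)
      (+-nonneg (*-nonneg (≤⇒0≤- u) (≤⇒0≤- l′)) (*-nonneg (≤⇒0≤- l) (≤⇒0≤- u′)))))

  abstract
    ∣∣<-bound : ∀ x → ∃[ n ] ∣ x ∣< ι (suc n)
    ∣∣<-bound x = m ℕ.+ n ,
      0<-⇒< (solve 2 (λ x k → x :- (:- k) := k :- (:- x)) refl x (ι (suc (m ℕ.+ n))))
        (<⇒0<- (<-≤-trans -x<ιn (ι-mono-≤ (ℕ.m≤n⇒m≤1+n (ℕ.m≤n+m n m))))) ,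
      <-≤-trans x<ιm (ι-mono-≤ (ℕ.m≤n⇒m≤1+n (ℕ.m≤m+n m n)))
      where
      m n : ℕ
      m = proj₁ (archimedean x)
      n = proj₁ (archimedean (- x))
      x<ιm : x < ι m
      x<ιm = proj₂ (archimedean x)
      -x<ιn : - x < ι n
      -x<ιn = proj₂ (archimedean (- x))

  abstract
    divide : 0# < d → 0# < e → ∃[ r ] 0# < r × d * r ≈ e
    divide {d} {e} 0<d 0<e = i * e , *-pos (1/-pos d#0 0<d) 0<e ,
      trans (sym (*-assoc d i e)) (trans (*-congʳ (1/-inverseʳ d#0)) (*-identityˡ e))
      where
      d#0 : d # 0#
      d#0 = 0<⇒#0 0<d
      i : Carrier
      i = 1/ d ⟨ d#0 ⟩

  ⟶-near : s ⟶ L → 0# < e → ∃[ N ] ∀ n → N ℕ.≤ n → ∣ s n - L ∣< e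
  ⟶-near {s} {L} {e} s⟶L 0<e = let N , near = s⟶L e 0<e in N , λ n N≤n →
    0<-⇒< (solve 3 (λ s L e → s :- L :- (:- e) := s :- (L :- e)) refl (s n) L e)
      (<⇒0<- (proj₁ (near n N≤n))) ,
    0<-⇒< (solve 3 (λ s L e → e :- (s :- L) := L :+ e :- s) refl (s n) L e)
      (<⇒0<- (proj₂ (near n N≤n)))

  near-⟶ : (∀ e → 0# < e → ∃[ N ] ∀ n → N ℕ.≤ n → ∣ s n - L ∣< e) → s ⟶ L
  near-⟶ {s} {L} near e 0<e = let N , close = near e 0<e in N , λ n N≤n →
    0<-⇒< (solve 3 (λ s L e → s :- (L :- e) := s :- L :- (:- e)) refl (s n) L e)
      (<⇒0<- (proj₁ (close n N≤n))) ,
    0<-⇒< (solve 3 (λ s L e → L :+ e :- s := e :- (s :- L)) refl (s n) L e)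
      (<⇒0<- (proj₂ (close n N≤n)))

  ⟶-cong : (∀ n → s n ≈ t n) → s ⟶ L → t ⟶ L
  ⟶-cong s≈t s⟶L e 0<e = let N , near = s⟶L e 0<e in N , λ n N≤n →
    <-respʳ-≈ (s≈t n) (proj₁ (near n N≤n)) , <-respˡ-≈ (s≈t n) (proj₂ (near n N≤n))

  ⟶-const : ∀ x → (λ _ → x) ⟶ x
  ⟶-const x = near-⟶ λ e 0<e → 0 , λ _ _ →
    ∣∣≤⇒< (∣∣≤-resp (sym (-‿inverseʳ x)) refl (nonneg⇒∣∣≤ (≤-reflexive refl))) 0<e

  ⟶-+ : s ⟶ L → t ⟶ M → (λ n → s n + t n) ⟶ (L + M)
  ⟶-+ {s} {L} {t} {M} s⟶L t⟶M = near-⟶ go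
    where
    go : ∀ e → 0# < e → ∃[ N ] ∀ n → N ℕ.≤ n → ∣ s n + t n - (L + M) ∣< e
    go e 0<e =
      let h , 0<h , h+h≈e = <-half 0<e
          N₁ , near₁ = ⟶-near s⟶L 0<h
          N₂ , near₂ = ⟶-near t⟶M 0<h
      in N₁ ℕ.⊔ N₂ , λ n N≤n → ∣∣<-resp
      (solve 4 (λ s t L M → s :- L :+ (t :- M) := s :+ t :- (L :+ M)) refl (s n) (t n) L M) h+h≈e
      (∣∣<-+ (near₁ n (ℕ.m⊔n≤o⇒m≤o N₁ N₂ N≤n)) (near₂ n (ℕ.m⊔n≤o⇒n≤o N₁ N₂ N≤n)))

  ⟶0-*-bounded : ∀ {C} N₀ → 0# < C → (∀ n → N₀ ℕ.≤ n → ∣ s n ∣< C) →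
                  t ⟶ 0# → (λ n → s n * t n) ⟶ 0#
  ⟶0-*-bounded {s} {t} {C} N₀ 0<C s<C t⟶0 = near-⟶ go
    where
    go : ∀ e → 0# < e → ∃[ N ] ∀ n → N ℕ.≤ n → ∣ s n * t n - 0# ∣< e
    go e 0<e =
      let r , 0<r , Cr≈e = divide 0<C 0<e
          N , near = ⟶-near t⟶0 0<r
      in N₀ ℕ.⊔ N , λ n N≤n → ∣∣<-resp
      (solve 2 (λ s t → s :* (t :- :0) := s :* t :- :0) refl (s n) (t n)) Cr≈e
      (∣∣<-* (s<C n (ℕ.m⊔n≤o⇒m≤o N₀ N N≤n)) (near n (ℕ.m⊔n≤o⇒n≤o N₀ N N≤n)))

  ⟶-bounded : s ⟶ L → ∃[ C ] 0# < C × ∃[ N ] ∀ n → N ℕ.≤ n → ∣ s n ∣< C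
  ⟶-bounded {s} {L} s⟶L =
    let k , ∣L∣<k = ∣∣<-bound L
        N , near = ⟶-near s⟶L 0<1
    in 1# + ι (suc k) , +-pos 0<1 (0<ι-suc k) , N , λ n N≤n →
    ∣∣<-resp (solve 2 (λ s L → s :- L :+ L := s) refl (s n) L) refl (∣∣<-+ (near n N≤n) ∣L∣<k)

  ⟶-difference : s ⟶ L → (λ n → s n - L) ⟶ 0#
  ⟶-difference {s} {L} s⟶L = near-⟶ λ e 0<e →
    let N , near = ⟶-near s⟶L 0<e
    in N , λ n N≤n → ∣∣<-resp (sym (x-0≈x _)) refl (near n N≤n)

  -- s t - L M = s (t - M) + M (s - L)
  ⟶-* : s ⟶ L → t ⟶ M → (λ n → s n * t n) ⟶ (L * M)
  ⟶-* {s} {L} {t} {M} s⟶L t⟶M = ⟶-resp (trans (+-congˡ (+-identityˡ 0#)) (+-identityʳ (L * M)))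
    (⟶-cong
      (λ n → solve 4 (λ s t L M → L :* M :+ (s :* (t :- M) :+ M :* (s :- L)) := s :* t)
               refl (s n) (t n) L M)
      (⟶-+ (⟶-const (L * M)) (⟶-+ s[t-M]⟶0 M[s-L]⟶0)))
    where
    ⟶-resp : ∀ {s L M} → L ≈ M → s ⟶ L → s ⟶ M
    ⟶-resp L≈M s⟶L e 0<e = let N , near = s⟶L e 0<e in
      N , λ n N≤n → <-respˡ-≈ (+-congʳ L≈M) (proj₁ (near n N≤n)) ,
                    <-respʳ-≈ (+-congʳ L≈M) (proj₂ (near n N≤n))
    s[t-M]⟶0 : (λ n → s n * (t n - M)) ⟶ 0#
    s[t-M]⟶0 = let C , 0<C , N , bnd = ⟶-bounded s⟶L in
      ⟶0-*-bounded N 0<C bnd (⟶-difference t⟶M)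
    M[s-L]⟶0 : (λ n → M * (s n - L)) ⟶ 0#
    M[s-L]⟶0 = let k , ∣M∣<k = ∣∣<-bound M in
      ⟶0-*-bounded 0 (0<ι-suc k) (λ _ _ → ∣M∣<k) (⟶-difference s⟶L)

  ⟶-*ˡ : ∀ x → s ⟶ L → (λ n → x * s n) ⟶ (x * L)
  ⟶-*ˡ x = ⟶-* (⟶-const x)

  ⟶-neg : s ⟶ L → (λ n → - s n) ⟶ (- L)
  ⟶-neg {s} {L} s⟶L = near-⟶ λ e 0<e →
    let N , near = ⟶-near s⟶L 0<e
    in N , λ n N≤n → let l , u = near n N≤n in
      0<-⇒< (solve 3 (λ s L e → :- s :- (:- L) :- (:- e) := e :- (s :- L)) refl (s n) L e)
          (<⇒0<- u) ,
      0<-⇒< (solve 3 (λ s L e → e :- (:- s :- (:- L)) := s :- L :- (:- e)) refl (s n) L e) (<⇒0<- l)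

  ⟶-≥ : ∀ N₀ → (∀ n → N₀ ℕ.≤ n → x ≤ s n) → s ⟶ L → x ≤ L
  ⟶-≥ {x} {s} {L} N₀ x≤s s⟶L L<x = let N , near = s⟶L (x - L) (<⇒0<- L<x) in
    x≤s (N₀ ℕ.⊔ N) (ℕ.m≤m⊔n N₀ N)
    (<-respʳ-≈ (solve 2 (λ x L → L :+ (x :- L) := x) refl x L)
        (proj₂ (near (N₀ ℕ.⊔ N) (ℕ.m≤n⊔m N₀ N))))

  ⟶-≤ : ∀ N₀ → (∀ n → N₀ ℕ.≤ n → s n ≤ x) → s ⟶ L → L ≤ x
  ⟶-≤ {s} {x} {L} N₀ s≤x s⟶L x<L = let N , near = s⟶L (L - x) (<⇒0<- x<L) in
    s≤x (N₀ ℕ.⊔ N) (ℕ.m≤m⊔n N₀ N)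
    (<-respˡ-≈ (solve 2 (λ x L → L :- (L :- x) := x) refl x L)
        (proj₁ (near (N₀ ℕ.⊔ N) (ℕ.m≤n⊔m N₀ N))))

  ⟶-unique : s ⟶ L → s ⟶ M → L ≈ M
  ⟶-unique {s} {L} {M} s⟶L s⟶M =
    ≤-antisym (λ M<L → apart M<L s⟶M s⟶L) (λ L<M → apart L<M s⟶L s⟶M)
    where
    -- With h half the distance, L + h and M - h coincide, so a late `s n` would lie strictly on
    -- both sides of one point.
    apart : ∀ {L M} → L < M → s ⟶ L → s ⟶ M → ⊥
    apart {L} {M} L<M s⟶L s⟶M = <-irrefl (trans (+-congʳ L≈) M-h)
      (<-trans (proj₁ (near₂ N (ℕ.m≤n⊔m N₁ N₂))) (proj₂ (near₁ N (ℕ.m≤m⊔n N₁ N₂))))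
      where
      half = <-half (<⇒0<- L<M)
      h = proj₁ half
      0<h = proj₁ (proj₂ half)
      N₁ = proj₁ (s⟶L h 0<h)
      N₂ = proj₁ (s⟶M h 0<h)
      near₁ = proj₂ (s⟶L h 0<h)
      near₂ = proj₂ (s⟶M h 0<h)
      N = N₁ ℕ.⊔ N₂
      L≈ : M ≈ L + (h + h)
      L≈ = trans (solve 2 (λ L M → M := L :+ (M :- L)) refl L M)
          (+-congˡ (sym (proj₂ (proj₂ half))))
      M-h : L + (h + h) - h ≈ L + h
      M-h = solve 2 (λ L h → L :+ (h :+ h) :- h := L :+ h) refl L h

  -- Once n exceeds C / e, a bound C on n s forces s below e. It serves both for the terms of the
  -- exponential series and for the defect in the functional equation of Γ.
  ι-bounded⇒⟶0 : ∀ {C} N₀ → 0# < C → (∀ n → N₀ ℕ.≤ n → ∣ ι n * s n ∣< C) → s ⟶ 0#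
  ι-bounded⇒⟶0 {s} {C} N₀ 0<C bound = near-⟶ go
    where
    go : ∀ e → 0# < e → ∃[ N ] ∀ n → N ℕ.≤ n → ∣ s n - 0# ∣< e
    go e 0<e = N₀ ℕ.⊔ suc K , λ n N≤n → near n (ℕ.m⊔n≤o⇒m≤o N₀ (suc K) N≤n)
        (ℕ.m⊔n≤o⇒n≤o N₀ (suc K) N≤n)
      where
      quotient = divide 0<e 0<C
      r = proj₁ quotient
      0<r = proj₁ (proj₂ quotient)
      er≈C = proj₂ (proj₂ quotient)
      K = proj₁ (archimedean r)
      r<ιK = proj₂ (archimedean r)
      near : ∀ n → N₀ ℕ.≤ n → suc K ℕ.≤ n → ∣ s n - 0# ∣< e
      near n N₀≤n K<n = ∣∣<-resp (sym (x-0≈x _)) refl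
        ( *-cancelˡ-< 0<ιn (<-trans (<-resp
            (solve 2 (λ e n → (:- (e :* n)) := n :* (:- e)) refl e (ι n)) refl
            (0<-⇒< (solve 2 (λ C en → :- C :- (:- en) := en :- C) refl C (e * ι n)) (<⇒0<- C<eιn)))
            (proj₁ (bound n N₀≤n)))
        , *-cancelˡ-< 0<ιn (<-trans (proj₂ (bound n N₀≤n)) (<-respʳ-≈ (*-comm e (ι n)) C<eιn)) )
        where
        r<ιn : r < ι n
        r<ιn = <-trans r<ιK (ι-mono-< K<n)
        0<ιn : 0# < ι n
        0<ιn = <-trans 0<r r<ιn
        C<eιn : C < e * ι n
        C<eιn = <-respˡ-≈ er≈C (*-monoˡ-< 0<e r<ιn)

-- Cauchy products and partial sums of the exponential series

module Exponential {c ℓ₁ ℓ₂ ℓ₃} (ℝ : RealNumbers c ℓ₁ ℓ₂ ℓ₃) where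

  open Limits ℝ public

  private variable
    x y X Y : Carrier

  -- The coefficient of index n in the product of two generating series. The recursion peels off the
  -- low end of `f`; `conv-last` peels off the other end.
  conv : (f g : ℕ → Carrier) → ℕ → Carrier
  conv f g zero    = f 0 * g 0
  conv f g (suc n) = f 0 * g (suc n) + conv (f ∘ suc) g n

  conv-cong : ∀ {f f′ g g′} n → (∀ i → f i ≈ f′ i) → (∀ i → g i ≈ g′ i) → conv f g n ≈ conv f′ g′ n
  conv-cong zero    f≈ g≈ = *-cong (f≈ 0) (g≈ 0)
  conv-cong (suc n) f≈ g≈ = +-cong (*-cong (f≈ 0) (g≈ (suc n))) (conv-cong n (f≈ ∘ suc) g≈)

  conv-+ˡ : ∀ f f′ g n → conv (λ i → f i + f′ i) g n ≈ conv f g n + conv f′ g n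
  conv-+ˡ f f′ g zero    = distribʳ _ _ _
  conv-+ˡ f f′ g (suc n) = trans (+-congˡ (conv-+ˡ (f ∘ suc) (f′ ∘ suc) g n))
    (solve 5 (λ f f′ g c c′ → (f :+ f′) :* g :+ (c :+ c′) := (f :* g :+ c) :+ (f′ :* g :+ c′)) refl
      (f 0) (f′ 0) (g (suc n)) (conv (f ∘ suc) g n) (conv (f′ ∘ suc) g n))

  conv-+ʳ : ∀ f g g′ n → conv f (λ i → g i + g′ i) n ≈ conv f g n + conv f g′ n
  conv-+ʳ f g g′ zero    = distribˡ _ _ _
  conv-+ʳ f g g′ (suc n) = trans (+-congˡ (conv-+ʳ (f ∘ suc) g g′ n))
    (solve 5 (λ f g g′ c c′ → f :* (g :+ g′) :+ (c :+ c′) := (f :* g :+ c) :+ (f :* g′ :+ c′)) refl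
      (f 0) (g (suc n)) (g′ (suc n)) (conv (f ∘ suc) g n) (conv (f ∘ suc) g′ n))

  conv-*ˡ : ∀ x f g n → conv (λ i → x * f i) g n ≈ x * conv f g n
  conv-*ˡ x f g zero    = *-assoc _ _ _
  conv-*ˡ x f g (suc n) = trans (+-congˡ (conv-*ˡ x (f ∘ suc) g n))
    (solve 4 (λ x f g c → x :* f :* g :+ x :* c := x :* (f :* g :+ c)) refl
      x (f 0) (g (suc n)) (conv (f ∘ suc) g n))

  conv-*ʳ : ∀ x f g n → conv f (λ i → x * g i) n ≈ x * conv f g n
  conv-*ʳ x f g zero    = solve 3 (λ x f g → f :* (x :* g) := x :* (f :* g)) refl x (f 0) (g 0)
  conv-*ʳ x f g (suc n) = trans (+-congˡ (conv-*ʳ x (f ∘ suc) g n))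
    (solve 4 (λ x f g c → f :* (x :* g) :+ x :* c := x :* (f :* g :+ c)) refl
      x (f 0) (g (suc n)) (conv (f ∘ suc) g n))

  conv-last : ∀ f g n → conv f g (suc n) ≈ conv f (g ∘ suc) n + f (suc n) * g 0
  conv-last f g zero    = refl
  conv-last f g (suc n) = trans (+-congˡ (conv-last (f ∘ suc) g n)) (sym (+-assoc _ _ _))

  -- The Leibniz rule for z d/dz on generating series: i + j = n in every product, so weighting by i
  -- and by j adds up to weighting by n.
  conv-derivation : ∀ f g n →
    conv (λ i → ι i * f i) g n + conv f (λ i → ι i * g i) n ≈ ι n * conv f g n
  conv-derivation f g zero    =
    solve 2 (λ f g → :0 :* f :* g :+ f :* (:0 :* g) := :0 :* (f :* g)) refl (f 0) (g 0)
  conv-derivation f g (suc n) = begin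
    (0# * f₀ * g₁ + conv (λ i → (1# + ι i) * f (suc i)) g n) + (f₀ * (ι (suc n) * g₁) + c₃)
      ≈⟨ +-congʳ (+-congˡ (trans
          (conv-cong n (λ i → trans (distribʳ _ _ _) (+-congʳ (*-identityˡ _))) (λ _ → refl))
                                 (conv-+ˡ (f ∘ suc) _ g n))) ⟩
    (0# * f₀ * g₁ + (c₁ + c₂)) + (f₀ * (ι (suc n) * g₁) + c₃)
      ≈⟨ solve 6 (λ f g c₁ c₂ c₃ n → (:0 :* f :* g :+ (c₁ :+ c₂)) :+ (f :* ((:1 :+ n) :* g) :+ c₃)
                    := (:1 :+ n) :* (f :* g) :+ (c₁ :+ (c₂ :+ c₃))) refl f₀ g₁ c₁ c₂ c₃ (ι n) ⟩
    ι (suc n) * (f₀ * g₁) + (c₁ + (c₂ + c₃))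
      ≈⟨ +-congˡ (+-congˡ (conv-derivation (f ∘ suc) g n)) ⟩
    ι (suc n) * (f₀ * g₁) + (c₁ + ι n * c₁)
      ≈⟨ solve 3 (λ a c n → (:1 :+ n) :* a :+ (c :+ n :* c) := (:1 :+ n) :* (a :+ c)) refl
          (f₀ * g₁) c₁ (ι n) ⟩
    ι (suc n) * (f₀ * g₁ + c₁) ∎
    where
    open ≈-Reasoning
    f₀ = f 0
    g₁ = g (suc n)
    c₁ = conv (f ∘ suc) g n
    c₂ = conv (λ i → ι i * f (suc i)) g n
    c₃ = conv (f ∘ suc) (λ i → ι i * g i) n

  conv-∣∣≤ : ∀ {f g F G} n → (∀ i → ∣ f i ∣≤ F i) → (∀ i → i ℕ.≤ n → ∣ g i ∣≤ G i) →
            ∣ conv f g n ∣≤ conv F G n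
  conv-∣∣≤ zero    f≤ g≤ = ∣∣≤-* (f≤ 0) (g≤ 0 ℕ.z≤n)
  conv-∣∣≤ (suc n) f≤ g≤ = ∣∣≤-+ (∣∣≤-* (f≤ 0) (g≤ (suc n) ℕ.≤-refl))
    (conv-∣∣≤ n (f≤ ∘ suc) (λ i i≤n → g≤ i (ℕ.m≤n⇒m≤1+n i≤n)))

  conv-nonneg : ∀ {f g} n → (∀ i → 0# ≤ f i) → (∀ i → 0# ≤ g i) → 0# ≤ conv f g n
  conv-nonneg zero    0≤f 0≤g = *-nonneg (0≤f 0) (0≤g 0)
  conv-nonneg (suc n) 0≤f 0≤g = +-nonneg (*-nonneg (0≤f 0) (0≤g (suc n)))
      (conv-nonneg n (0≤f ∘ suc) 0≤g)

  ≤-refl : x ≤ x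
  ≤-refl = ≤-reflexive refl

  x≤x+nonneg : ∀ {x y} → 0# ≤ y → x ≤ x + y
  x≤x+nonneg {x} 0≤y = ≤-resp (+-identityʳ x) refl (+-mono-≤ ≤-refl 0≤y)

  -- For i ≤ m the partner of `f i` in the longer sum has index m + n - i ≥ n and thus dominates
  -- `z`; the further products are nonnegative.
  conv-const-≤ : ∀ {f g z} m n → (∀ i → 0# ≤ f i) → (∀ i → 0# ≤ g i) → 0# ≤ z →
                 (∀ i → n ℕ.≤ i → z ≤ g i) → conv f (λ _ → z) m ≤ conv f g (m ℕ.+ n)
  conv-const-≤ zero zero    0≤f 0≤g 0≤z z≤g = *-mono-≤ (0≤f 0) ≤-refl 0≤z (z≤g 0 ℕ.z≤n)
  conv-const-≤ zero (suc n) 0≤f 0≤g 0≤z z≤g = ≤-trans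
    (*-mono-≤ (0≤f 0) ≤-refl 0≤z (z≤g (suc n) ℕ.≤-refl))
    (x≤x+nonneg (conv-nonneg n (0≤f ∘ suc) 0≤g))
  conv-const-≤ (suc m) n    0≤f 0≤g 0≤z z≤g = +-mono-≤
    (*-mono-≤ (0≤f 0) ≤-refl 0≤z (z≤g (suc (m ℕ.+ n)) (ℕ.m≤n⇒m≤1+n (ℕ.m≤n+m n m))))
    (conv-const-≤ m n (0≤f ∘ suc) 0≤g 0≤z z≤g)

  abstract
    -- Opaque, so that factorials and inverses stay folded in the estimates; the recursion
    -- `term-suc` is the interface.
    term : Carrier → ℕ → Carrier
    term = expTerm

    expSum : Carrier → ℕ → Carrier
    expSum x n = sum {n} (λ k → expTerm x (toℕ k))

    IsExp⇒expSum⟶ : IsExp x y → expSum x ⟶ y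
    IsExp⇒expSum⟶ isExp = isExp

    expSum-zero : ∀ x → expSum x 0 ≈ 0#
    expSum-zero x = refl

    expSum-suc : ∀ x n → expSum x (suc n) ≈ expSum x n + term x n
    expSum-suc x = go (expTerm x)
      where
      go : ∀ f n → sum {suc n} (f ∘ toℕ) ≈ sum {n} (f ∘ toℕ) + f n
      go f zero    = trans (+-identityʳ _) (sym (+-identityˡ _))
      go f (suc n) = trans (+-congˡ (go (f ∘ suc) n)) (sym (+-assoc _ _ _))

    term-zero : ∀ x → term x 0 ≈ 1#
    term-zero x = trans (*-identityˡ _)
      (sym (1/-unique _ (trans (*-identityʳ _) (+-identityʳ 1#))))

    term-suc : ∀ x k → ι (suc k) * term x (suc k) ≈ x * term x k
    term-suc x k = begin
      ι (suc k) * (x * x ^ k * b)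
          ≈⟨ solve 4 (λ s x p b → s :* (x :* p :* b) := x :* (p :* (b :* s))) refl (ι (suc k)) x
              (x ^ k) b ⟩
      x * (x ^ k * (b * ι (suc k)))  ≈⟨ *-congˡ (*-congˡ (1/-unique (ι!#0 k) b-recip)) ⟩
      x * (x ^ k * 1/ ι (k !) ⟨ ι!#0 k ⟩) ∎
      where
      open ≈-Reasoning
      ι!#0 : ∀ n → ι (n !) # 0#
      ι!#0 n = 0<⇒#0 (0<ι (n !) {{n ℕ.!≢0}})
      b : Carrier
      b = 1/ ι (suc k !) ⟨ ι!#0 (suc k) ⟩
      b-recip : ι (k !) * (b * ι (suc k)) ≈ 1#
      b-recip = begin
        ι (k !) * (b * ι (suc k))
            ≈⟨ solve 3 (λ f b s → f :* (b :* s) := b :* (s :* f)) refl (ι (k !)) b (ι (suc k)) ⟩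
        b * (ι (suc k) * ι (k !))  ≈⟨ *-congˡ (ι-* (suc k) (k !)) ⟨
        b * ι (suc k !)            ≈⟨ 1/-inverseˡ (ι!#0 (suc k)) ⟩
        1#                         ∎

    term-cong : ∀ k → x ≈ y → term x k ≈ term y k
    term-cong k x≈y = *-congʳ (^-congˡ k x≈y)

    ^-∣∣≤ : ∀ k → ∣ x ∣≤ X → ∣ x ^ k ∣≤ X ^ k
    ^-∣∣≤ zero    x≤X = nonneg⇒∣∣≤ 0≤1
    ^-∣∣≤ (suc k) x≤X = ∣∣≤-* x≤X (^-∣∣≤ k x≤X)

    term-∣∣≤ : ∀ k → ∣ x ∣≤ X → ∣ term x k ∣≤ term X k
    term-∣∣≤ k x≤X = ∣∣≤-* (^-∣∣≤ k x≤X)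
      (nonneg⇒∣∣≤ (<⇒≤ (1/-pos _ (0<ι (k !) {{k ℕ.!≢0}}))))

    term-nonneg : ∀ k → 0# ≤ x → 0# ≤ term x k
    term-nonneg k 0≤x = *-nonneg (^-nonneg 0≤x k) (<⇒≤ (1/-pos _ (0<ι (k !) {{k ℕ.!≢0}})))

  expSum-cong : ∀ n → x ≈ y → expSum x n ≈ expSum y n
  expSum-cong zero    x≈y = trans (expSum-zero _) (sym (expSum-zero _))
  expSum-cong (suc n) x≈y = trans (expSum-suc _ n)
    (trans (+-cong (expSum-cong n x≈y) (term-cong n x≈y)) (sym (expSum-suc _ n)))

  expSum-nonneg : ∀ n → 0# ≤ x → 0# ≤ expSum x n
  expSum-nonneg zero    0≤x = ≤-reflexive (sym (expSum-zero _))
  expSum-nonneg (suc n) 0≤x = ≤-resp refl (sym (expSum-suc _ n))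
    (+-nonneg (expSum-nonneg n 0≤x) (term-nonneg n 0≤x))

  abstract
    -- Both sides obey (n + 1) c (n + 1) = (x + y) c n, the differential equation of the exponential
    -- read off coefficients: on the left the Leibniz rule splits n + 1, and `term-suc` turns the
    -- two parts into x and y.
    term-binomial : ∀ x y n → conv (term x) (term y) n ≈ term (x + y) n
    term-binomial x y zero    = begin
      term x 0 * term y 0  ≈⟨ *-cong (term-zero x) (term-zero y) ⟩
      1# * 1#                    ≈⟨ *-identityˡ 1# ⟩
      1#                         ≈⟨ term-zero (x + y) ⟨
      term (x + y) 0          ∎
      where open ≈-Reasoning
    term-binomial x y (suc n) = *-cancelˡ (0<ι-suc n) $ begin
      ι (suc n) * conv u v (suc n)
        ≈⟨ conv-derivation u v (suc n) ⟨
      (0# * u 0 * v (suc n) + conv (λ i → ι (suc i) * u (suc i)) v n) + conv u (λ i → ι i * v i)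
          (suc n)
        ≈⟨ +-cong (trans (+-cong (solve 2 (λ a b → :0 :* a :* b := :0) refl (u 0) (v (suc n)))
                                 (trans (conv-cong n (term-suc x) (λ _ → refl)) (conv-*ˡ x u v n)))
                         (+-identityˡ _))
                  (trans (conv-last u _ n)
                    (trans (+-cong (trans (conv-cong n (λ _ → refl) (term-suc y)) (conv-*ʳ y u v n))
                                   (solve 2 (λ a b → a :* (:0 :* b) := :0) refl (u (suc n)) (v 0)))
                           (+-identityʳ _))) ⟩
      x * conv u v n + y * conv u v n
        ≈⟨ distribʳ _ _ _ ⟨
      (x + y) * conv u v n
        ≈⟨ *-congˡ (term-binomial x y n) ⟩
      (x + y) * term (x + y) n
        ≈⟨ term-suc (x + y) n ⟨
      ι (suc n) * term (x + y) (suc n) ∎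
      where
      open ≈-Reasoning
      u v : ℕ → Carrier
      u = term x
      v = term y

    -- This is `term-binomial` summed over the index: in generating series both sides acquire the
    -- factor z / (1 - z).
    expSum-+ : ∀ x y n → conv (term x) (expSum y) n ≈ expSum (x + y) n
    expSum-+ x y zero    =
      trans (*-congˡ (expSum-zero y)) (trans (zeroʳ _) (sym (expSum-zero (x + y))))
    expSum-+ x y (suc n) = begin
      conv u (expSum y) (suc n)
        ≈⟨ conv-last u (expSum y) n ⟩
      conv u (expSum y ∘ suc) n + u (suc n) * expSum y 0
        ≈⟨ +-cong (conv-cong n (λ _ → refl) (expSum-suc y))
            (trans (*-congˡ (expSum-zero y)) (zeroʳ _)) ⟩
      conv u (λ i → expSum y i + term y i) n + 0#
        ≈⟨ trans (+-identityʳ _) (conv-+ʳ u (expSum y) (term y) n) ⟩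
      conv u (expSum y) n + conv u (term y) n
        ≈⟨ +-cong (expSum-+ x y n) (term-binomial x y n) ⟩
      expSum (x + y) n + term (x + y) n
        ≈⟨ expSum-suc (x + y) n ⟨
      expSum (x + y) (suc n) ∎
      where
      open ≈-Reasoning
      u : ℕ → Carrier
      u = term x

  conv-const : ∀ x z n → conv (term x) (λ _ → z) n ≈ expSum x (suc n) * z
  conv-const x z zero    = *-congʳ (sym (trans (expSum-suc x 0)
    (trans (+-congʳ (expSum-zero x)) (+-identityˡ _))))
  conv-const x z (suc n) = trans (conv-last (term x) _ n) (trans (+-congʳ (conv-const x z n))
    (trans (sym (distribʳ _ _ _)) (*-congʳ (sym (expSum-suc x (suc n))))))

  expSum-increment-∣∣≤ : ∣ x ∣≤ X → ∀ n d →
    ∣ expSum x (n ℕ.+ d) - expSum x n ∣≤ expSum X (n ℕ.+ d) - expSum X n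
  expSum-increment-∣∣≤ {x} {X} x≤X n zero rewrite ℕ.+-identityʳ n =
    ∣∣≤-resp (sym (-‿inverseʳ _)) (sym (-‿inverseʳ _)) (nonneg⇒∣∣≤ ≤-refl)
  expSum-increment-∣∣≤ {x} {X} x≤X n (suc d) rewrite ℕ.+-suc n d =
    ∣∣≤-resp (step x) (step X) (∣∣≤-+ (expSum-increment-∣∣≤ x≤X n d) (term-∣∣≤ (n ℕ.+ d) x≤X))
    where
    step : ∀ z → expSum z (n ℕ.+ d) - expSum z n + term z (n ℕ.+ d)
               ≈ expSum z (suc (n ℕ.+ d)) - expSum z n
    step z = trans (solve 3 (λ a b t → a :- b :+ t := a :+ t :- b) refl _ _ _)
                   (+-congʳ (sym (expSum-suc z (n ℕ.+ d))))

  expSum-increment-∣∣≤′ : ∣ x ∣≤ X → ∀ {m n} → m ℕ.≤ n →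
    ∣ expSum x n - expSum x m ∣≤ expSum X n - expSum X m
  expSum-increment-∣∣≤′ {X = X} x≤X {m} {n} m≤n =
    ≡.subst (λ k → ∣ expSum _ k - expSum _ m ∣≤ expSum X k - expSum X m) (ℕ.m+[n∸m]≡n m≤n)
      (expSum-increment-∣∣≤ x≤X m (n ℕ.∸ m))

  expSum-mono : 0# ≤ x → ∀ {m n} → m ℕ.≤ n → expSum x m ≤ expSum x n
  expSum-mono 0≤x m≤n =
    0≤-⇒≤ refl (∣∣≤-nonneg (expSum-increment-∣∣≤′ (nonneg⇒∣∣≤ 0≤x) m≤n))

  -- The error is a sum of products of x- and y-terms, hence dominated by the
  -- same sum for X and Y, which consists of terms of the product series for
  -- X + Y of index between n and 2n.
  expSum-*-error : ∣ x ∣≤ X → ∣ y ∣≤ Y → ∀ n →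
    ∣ expSum x (suc n) * expSum y n - expSum (x + y) n ∣≤
    expSum (X + Y) (n ℕ.+ n) - expSum (X + Y) n
  expSum-*-error {x} {X} {y} {Y} x≤X y≤Y n = ∣∣≤-weaken
    (∣∣≤-resp (error≈ x y) (error≈ X Y)
      (conv-∣∣≤ n (λ i → term-∣∣≤ i x≤X) (λ i i≤n → expSum-increment-∣∣≤′ y≤Y i≤n)))
    (+-mono-≤ (≤-resp (conv-const _ _ n) (expSum-+ X Y (n ℕ.+ n))
                (conv-const-≤ n n (λ i → term-nonneg i 0≤X) (λ i → expSum-nonneg i 0≤Y)
                  (expSum-nonneg n 0≤Y) (λ i n≤i → expSum-mono 0≤Y n≤i)))
              ≤-refl)
    where
    0≤X = ∣∣≤-nonneg x≤X
    0≤Y = ∣∣≤-nonneg y≤Y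
    error≈ : ∀ x y → conv (term x) (λ i → expSum y n - expSum y i) n
                   ≈ expSum x (suc n) * expSum y n - expSum (x + y) n
    error≈ x y = begin
      conv (term x) (λ i → expSum y n - expSum y i) n
        ≈⟨ conv-+ʳ _ _ _ n ⟩
      conv (term x) (λ _ → expSum y n) n + conv (term x) (λ i → - expSum y i) n
        ≈⟨ +-cong (conv-const _ _ n)
             (trans (conv-cong n (λ _ → refl)
                 (λ i → solve 1 (λ z → :- z := (:- :1) :* z) refl (expSum y i)))
                    (trans (conv-*ʳ (- 1#) _ _ n) (*-congˡ (expSum-+ x y n)))) ⟩
      expSum x (suc n) * expSum y n + - 1# * expSum (x + y) n
        ≈⟨ solve 2 (λ a b → a :+ (:- :1) :* b := a :- b) refl _ _ ⟩
      expSum x (suc n) * expSum y n - expSum (x + y) n ∎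
      where open ≈-Reasoning

-- The exponential function

module ExponentialLimit {c ℓ₁ ℓ₂ ℓ₃} (ℝ : RealNumbers c ℓ₁ ℓ₂ ℓ₃) where

  open Exponential ℝ public

  private variable
    x y d X Y : Carrier

  y+[x-y]≈x : ∀ x y → y + (x - y) ≈ x
  y+[x-y]≈x = solve 2 (λ x y → y :+ (x :- y) := x) refl

  module Tail {z} (0≤z : 0# ≤ z) where

    private
      2z : ∃[ n ] (z + z < ι n)
      2z = archimedean (z + z)

      K : ℕ
      K = proj₁ 2z

      t : ℕ → Carrier
      t = term z

      0≤t : ∀ n → 0# ≤ t n
      0≤t n = term-nonneg n 0≤z

    -- The ratio of consecutive terms is z / (n + 1), which is at most one half because `K` exceeds
    -- 2 z.
    halving : ∀ n → K ℕ.≤ n → t (suc n) + t (suc n) ≤ t n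
    halving n K≤n = *-cancelˡ-≤ (0<ι-suc n) $ ≤-resp
      (trans (solve 2 (λ z t → (z :+ z) :* t := z :* t :+ z :* t) refl z (t n))
        (trans (+-cong (sym (term-suc z n)) (sym (term-suc z n))) (sym (distribˡ _ _ _))))
      refl
      (*-mono-≤ (+-nonneg 0≤z 0≤z)
        (≤-trans (<⇒≤ (proj₂ 2z)) (ι-mono-≤ (ℕ.m≤n⇒m≤1+n K≤n))) (0≤t n) ≤-refl)

    -- The induction carries the extra summand 2 t (n + d), a budget for the rest of the tail; by
    -- `halving`, paying one term out of it leaves enough for the next step.
    tail-≤ : ∀ n d → K ℕ.≤ n → expSum z (n ℕ.+ d) - expSum z n ≤ t n + t n
    tail-≤ n d K≤n = ≤-trans (x≤x+nonneg (+-nonneg (0≤t (n ℕ.+ d)) (0≤t (n ℕ.+ d)))) (go d)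
      where
      go : ∀ d → expSum z (n ℕ.+ d) - expSum z n + (t (n ℕ.+ d) + t (n ℕ.+ d)) ≤ t n + t n
      go zero rewrite ℕ.+-identityʳ n =
        ≤-reflexive (trans (+-congʳ (-‿inverseʳ _)) (+-identityˡ _))
      go (suc d) rewrite ℕ.+-suc n d = ≤-trans
        (≤-resp
          (sym (trans (+-congʳ (+-congʳ (expSum-suc z (n ℕ.+ d))))
            (solve 4 (λ a t b t′ → a :+ t :- b :+ (t′ :+ t′) := a :- b :+ (t :+ (t′ :+ t′))) refl
              (expSum z (n ℕ.+ d)) (t (n ℕ.+ d)) (expSum z n) (t (suc (n ℕ.+ d))))))
          refl
          (+-mono-≤ ≤-refl (+-mono-≤ ≤-refl (halving (n ℕ.+ d) (ℕ.≤-trans K≤n (ℕ.m≤m+n n d))))))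
        (go d)

    t-≤ : ∀ d → t (K ℕ.+ d) ≤ t K
    t-≤ zero rewrite ℕ.+-identityʳ K = ≤-refl
    t-≤ (suc d) rewrite ℕ.+-suc K d = ≤-trans (x≤x+nonneg (0≤t (suc (K ℕ.+ d))))
      (≤-trans (halving (K ℕ.+ d) (ℕ.m≤m+n K d)) (t-≤ d))

    -- The product telescopes to z t (n - 1), and the terms do not grow beyond `K`. The added `1#`
    -- keeps the bound strict and positive even if `z` is zero.
    ιt-< : ∀ n → suc K ℕ.≤ n → ∣ ι n * t n ∣< z * t K + 1#
    ιt-< (suc n) (ℕ.s≤s K≤n) = ∣∣≤⇒< {d = z * t K}
      (∣∣≤-weaken (nonneg⇒∣∣≤ (*-nonneg (0≤ι (suc n)) (0≤t (suc n))))
        (≤-resp (sym (term-suc z n)) refl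
          (*-mono-≤ 0≤z ≤-refl (0≤t n)
            (≡.subst (λ k → t k ≤ t K) (ℕ.m+[n∸m]≡n K≤n) (t-≤ (n ℕ.∸ K))))))
      (0<-⇒< (solve 1 (λ a → a :+ :1 :- a := :1) refl (z * t K)) 0<1)

    t⟶0 : t ⟶ 0#
    t⟶0 = ι-bounded⇒⟶0 (suc K)
      (≤-<-trans (*-nonneg 0≤z (0≤t K))
          (0<-⇒< (solve 1 (λ a → a :+ :1 :- a := :1) refl (z * t K)) 0<1))
      ιt-<

    abstract
      tail-< : ∀ e → 0# < e → ∃[ N ] ∀ n → N ℕ.≤ n → ∀ d → expSum z (n ℕ.+ d) - expSum z n < e
      tail-< e 0<e =
        let h , 0<h , h+h≈e = <-half 0<e
            N , near = ⟶-near t⟶0 0<h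
        in K ℕ.⊔ N , λ n N≤n d →
          ≤-<-trans (tail-≤ n d (ℕ.m⊔n≤o⇒m≤o K N N≤n))
            (<-resp (+-cong (x-0≈x _) (x-0≈x _)) h+h≈e
              (proj₂ (∣∣<-+ (near n (ℕ.m⊔n≤o⇒n≤o K N N≤n)) (near n (ℕ.m⊔n≤o⇒n≤o K N N≤n)))))

  abstract
    bound : ∀ x → ∃[ X ] ∣ x ∣≤ X
    bound x = let n , x<n = ∣∣<-bound x in ι (suc n) , ∣∣<⇒≤ x<n

    expSum-cauchy : ∀ x → Cauchy (expSum x)
    expSum-cauchy x e 0<e =
      let X , x≤X = bound x
          h , 0<h , h+h≈e = <-half 0<e
          N , tail = Tail.tail-< (∣∣≤-nonneg x≤X) h 0<h
          close : ∀ n → N ℕ.≤ n → ∣ expSum x n - expSum x N ∣< h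
          close n N≤n = ∣∣≤⇒< (expSum-increment-∣∣≤′ x≤X N≤n)
            (≡.subst (λ k → expSum X k - expSum X N < h) (ℕ.m+[n∸m]≡n N≤n)
                (tail N ℕ.≤-refl (n ℕ.∸ N)))
      in N , λ m n N≤m N≤n →
        <-respʳ-≈ (+-congˡ h+h≈e) (0<-⇒<
          (solve 4 (λ m n k h → n :+ (h :+ h) :- m := (h :- (m :- k)) :+ (n :- k :- (:- h))) refl
            (expSum x m) (expSum x n) (expSum x N) h)
          (+-pos (<⇒0<- (proj₂ (close m N≤m))) (<⇒0<- (proj₁ (close n N≤n)))))

    -- Completeness supplies a total function, so that the relation `IsExp` can be replaced by
    -- equations.
    exp : Carrier → Carrier
    exp x = proj₁ (complete (expSum x) (expSum-cauchy x))

    expSum⟶exp : ∀ x → expSum x ⟶ exp x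
    expSum⟶exp x = proj₂ (complete (expSum x) (expSum-cauchy x))

    IsExp⇒≈exp : IsExp x y → y ≈ exp x
    IsExp⇒≈exp {x} isExp = ⟶-unique (IsExp⇒expSum⟶ isExp) (expSum⟶exp x)

    exp-cong : x ≈ y → exp x ≈ exp y
    exp-cong {x} {y} x≈y =
      ⟶-unique (⟶-cong (λ n → expSum-cong n x≈y) (expSum⟶exp x)) (expSum⟶exp y)

  ⟶-suc : ∀ {s L} → s ⟶ L → (s ∘ suc) ⟶ L
  ⟶-suc s⟶L e 0<e = let N , near = s⟶L e 0<e in N , λ n N≤n → near (suc n) (ℕ.m≤n⇒m≤1+n N≤n)

  -- One sequence of products has its limit computed twice: factor by factor, and as the partial sum
  -- for x + y plus an error that the tail of the series for X + Y forces to zero.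
  exp-+ : ∀ x y → exp (x + y) ≈ exp x * exp y
  exp-+ x y = begin
    exp (x + y)                            ≈⟨ +-identityʳ _ ⟨
    exp (x + y) + 0#                       ≈⟨ ⟶-unique products sums ⟨
    exp x * exp y                          ∎
    where
    open ≈-Reasoning
    boundX : ∃[ X ] ∣ x ∣≤ X
    boundX = bound x
    boundY : ∃[ Y ] ∣ y ∣≤ Y
    boundY = bound y
    error⟶0 : (λ n → expSum x (suc n) * expSum y n - expSum (x + y) n) ⟶ 0#
    error⟶0 = near-⟶ λ e 0<e →
      let N , tail = Tail.tail-< (∣∣≤-nonneg (∣∣≤-+ (proj₂ boundX) (proj₂ boundY))) e 0<e
      in N , λ n N≤n → ∣∣<-resp (sym (x-0≈x _)) refl
           (∣∣≤⇒< (expSum-*-error (proj₂ boundX) (proj₂ boundY) n) (tail n N≤n n))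
    products : (λ n → expSum x (suc n) * expSum y n) ⟶ (exp x * exp y)
    products = ⟶-* (⟶-suc (expSum⟶exp x)) (expSum⟶exp y)
    sums : (λ n → expSum x (suc n) * expSum y n) ⟶ (exp (x + y) + 0#)
    sums = ⟶-cong {s = λ n → expSum (x + y) n + (expSum x (suc n) * expSum y n - expSum (x + y) n)}
             (λ n → y+[x-y]≈x (expSum x (suc n) * expSum y n) (expSum (x + y) n))
             (⟶-+ (expSum⟶exp (x + y)) error⟶0)

  expSum-1 : ∀ x → expSum x 1 ≈ 1#
  expSum-1 x = trans (expSum-suc x 0)
      (trans (+-cong (expSum-zero x) (term-zero x)) (+-identityˡ 1#))

  expSum-2 : ∀ x → expSum x 2 ≈ 1# + x
  expSum-2 x = trans (expSum-suc x 1) (+-cong (expSum-1 x) x₁)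
    where
    x₁ : term x 1 ≈ x
    x₁ = trans (solve 1 (λ a → a := (:1 :+ :0) :* a) refl (term x 1))
      (trans (term-suc x 0) (trans (*-congˡ (term-zero x)) (*-identityʳ x)))

  exp-≥ : 0# ≤ x → 1# + x ≤ exp x
  exp-≥ {x} 0≤x = ⟶-≥ 2 (λ n 2≤n → ≤-resp (expSum-2 x) refl (expSum-mono 0≤x 2≤n)) (expSum⟶exp x)

  exp-0 : exp 0# ≈ 1#
  exp-0 = *-cancelˡ {x = exp 0#} 0<exp0
    (trans (sym (exp-+ 0# 0#)) (trans (exp-cong (+-identityˡ 0#)) (sym (*-identityʳ _))))
    where
    0<exp0 : 0# < exp 0#
    0<exp0 = <-≤-trans (<-respʳ-≈ (sym (+-identityʳ 1#)) 0<1) (exp-≥ ≤-refl)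

  exp-inverse : ∀ x → exp x * exp (- x) ≈ 1#
  exp-inverse x = trans (sym (exp-+ x (- x))) (trans (exp-cong (-‿inverseʳ x)) exp-0)

  half : ∀ x → ∃[ h ] h + h ≈ x
  half x =
    let h , _ , h+h≈1 = <-half 0<1
    in h * x , trans (sym (distribʳ x h h)) (trans (*-congʳ h+h≈1) (*-identityˡ x))

  nonneg∧#0⇒pos : 0# ≤ x → x # 0# → 0# < x
  nonneg∧#0⇒pos 0≤x x#0 = [ (λ x<0 → contradiction x<0 0≤x) , id ]′ (#⇒<⊎> x#0)

  -- Nonnegative as the square of `exp h` with h = x / 2, and apart from zero because `exp (- x)`
  -- inverts it. The terms of the series settle only the case of nonnegative `x`.
  exp-pos : ∀ x → 0# < exp x
  exp-pos x = nonneg∧#0⇒pos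
    (≤-resp refl (trans (sym (exp-+ h h)) (exp-cong (proj₂ (half x)))) (x*x-nonneg (exp h)))
    (xy#0⇒x#0 (#-congʳ (sym (exp-inverse x)) 1#0))
    where
    h : Carrier
    h = proj₁ (half x)

  exp-mono-< : x < y → exp x < exp y
  exp-mono-< {x} {y} x<y = <-resp (*-identityʳ (exp x))
    (trans (sym (exp-+ x (y - x))) (exp-cong (solve 2 (λ x y → x :+ (y :- x) := y) refl x y)))
    (*-monoˡ-< (exp-pos x) (<-≤-trans
      (0<-⇒< (solve 1 (λ d → :1 :+ d :- :1 := d) refl (y - x)) (<⇒0<- x<y))
      (exp-≥ (<⇒≤ (<⇒0<- x<y)))))

  exp-cancel-≤ : exp x ≤ exp y → x ≤ y
  exp-cancel-≤ ex≤ey y<x = ex≤ey (exp-mono-< y<x)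

  exp-injective : exp x ≈ exp y → x ≈ y
  exp-injective ex≈ey = ≤-antisym (exp-cancel-≤ (≤-reflexive ex≈ey))
      (exp-cancel-≤ (≤-reflexive (sym ex≈ey)))

  -- (1 - d) Σ_{k ≤ n} d^k / k! = 1 - Σ_{1 ≤ k ≤ n} (k - 1) d^k / k! - d^(n+1) / n!
  expSum-geometric : 0# ≤ d → ∀ n → (1# - d) * expSum d (suc n) + d * term d n ≤ 1#
  expSum-geometric {d} 0≤d zero = ≤-reflexive (trans
    (+-cong (*-congˡ (expSum-1 d)) (*-congˡ (term-zero d)))
    (solve 1 (λ d → (:1 :- d) :* :1 :+ d :* :1 := :1) refl d))
  expSum-geometric {d} 0≤d (suc n) = ≤-trans
    (0≤-⇒≤ (begin
        (1# - d) * E + d * t - ((1# - d) * expSum d (suc (suc n)) + d * t′)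
          ≈⟨ +-cong (+-congˡ (sym (term-suc d n)))
              (-‿cong (+-congʳ (*-congˡ (expSum-suc d (suc n))))) ⟩
        (1# - d) * E + (1# + ι n) * t′ - ((1# - d) * (E + t′) + d * t′)
          ≈⟨ solve 4 (λ d E t′ n → (:1 :- d) :* E :+ (:1 :+ n) :* t′ :-
              ((:1 :- d) :* (E :+ t′) :+ d :* t′)
                       := n :* t′) refl d E t′ (ι n) ⟩
        ι n * t′ ∎)
      (*-nonneg (0≤ι n) (term-nonneg (suc n) 0≤d)))
    (expSum-geometric 0≤d n)
    where
    open ≈-Reasoning
    E t t′ : Carrier
    E = expSum d (suc n)
    t = term d n
    t′ = term d (suc n)

  exp-geometric : 0# ≤ d → (1# - d) * exp d ≤ 1#
  exp-geometric {d} 0≤d = ⟶-≤ 1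
    (λ { (suc n) _ → ≤-trans (x≤x+nonneg (*-nonneg 0≤d (term-nonneg n 0≤d)))
        (expSum-geometric 0≤d n) })
    (⟶-*ˡ (1# - d) (expSum⟶exp d))

-- The functional equation and the positivity of the gamma function

module GammaFunction {c ℓ₁ ℓ₂ ℓ₃} (ℝ : RealNumbers c ℓ₁ ℓ₂ ℓ₃) where

  open ExponentialLimit ℝ public

  private variable
    x y : Carrier

  poch-cong : x ≈ y → ∀ k → poch x k ≈ poch y k
  poch-cong x≈y zero    = refl
  poch-cong x≈y (suc k) = *-cong (poch-cong x≈y k) (+-congʳ x≈y)

  poch-pos : 0# < x → ∀ k → 0# < poch x k
  poch-pos 0<x zero    = 0<1
  poch-pos 0<x (suc k) = *-pos (poch-pos 0<x k) (0<x+ι 0<x k)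

  poch-suc : ∀ x k → poch x (suc k) ≈ x * poch (x + 1#) k
  poch-suc x zero    = solve 1 (λ x → :1 :* (x :+ :0) := x :* :1) refl x
  poch-suc x (suc k) = trans (*-congʳ (poch-suc x k))
    (solve 3 (λ x p k → x :* p :* (x :+ (:1 :+ k)) := x :* (p :* (x :+ :1 :+ k))) refl
      x (poch (x + 1#) k) (ι k))

  module Gamma (Γ : ∀ x → 0# < x → Carrier) (isGamma : IsGamma Γ) where

    -- The indices are shifted by one: ln n is the logarithm of n + 1, and
    -- gauss x 0<x n is the approximant of Γ(x) of index n + 1.
    abstract
      ln : ℕ → Carrier
      ln n = proj₁ (proj₁ (proj₂ (isGamma 1# 0<1)) (suc n))

      exp-ln : ∀ n → exp (ln n) ≈ ι (suc n)
      exp-ln n = sym (IsExp⇒≈exp (proj₁ (proj₂ (proj₁ (proj₂ (isGamma 1# 0<1)) (suc n)))))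

      gauss : ∀ x → 0# < x → ℕ → Carrier
      gauss x 0<x n = ι (suc n !) * exp (x * ln n)
                      * 1/ poch x (suc (suc n)) ⟨ poch-#0 0<x (suc (suc n)) ⟩

      gauss-poch : ∀ x 0<x n → gauss x 0<x n * poch x (suc (suc n)) ≈ ι (suc n !) * exp (x * ln n)
      gauss-poch x 0<x n = trans (*-assoc _ _ _)
        (trans (*-congˡ (1/-inverseˡ (poch-#0 0<x (suc (suc n))))) (*-identityʳ _))

      -- `isGamma` brings along, for each x, its own logarithm of n + 1; injectivity of `exp`
      -- identifies it with `ln n`, which was taken at x = 1.
      gauss⟶Γ : ∀ x 0<x → gauss x 0<x ⟶ Γ x 0<x
      gauss⟶Γ x 0<x = ⟶-cong (λ n → *-congʳ (*-congˡ (power n)))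
          (⟶-suc (proj₂ (proj₂ (isGamma x 0<x))))
        where
        power : ∀ n → proj₁ (isGamma x 0<x) (suc n) ≈ exp (x * ln n)
        power n =
          let l , isExp-l , isExp-xl = proj₁ (proj₂ (isGamma x 0<x)) (suc n)
          in trans (IsExp⇒≈exp isExp-xl) (exp-cong (*-congˡ
               (exp-injective (trans (sym (IsExp⇒≈exp isExp-l)) (sym (exp-ln n))))))

    gauss-cong : x ≈ y → ∀ 0<x 0<y n → gauss x 0<x n ≈ gauss y 0<y n
    gauss-cong {x} {y} x≈y 0<x 0<y n = *-cancelˡ (poch-pos 0<x (suc (suc n))) $ begin
      poch x (2 ℕ.+ n) * gauss x 0<x n   ≈⟨ *-comm _ _ ⟩
      gauss x 0<x n * poch x (2 ℕ.+ n)   ≈⟨ gauss-poch x 0<x n ⟩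
      ι (suc n !) * exp (x * ln n)       ≈⟨ *-congˡ (exp-cong (*-congʳ x≈y)) ⟩
      ι (suc n !) * exp (y * ln n)       ≈⟨ gauss-poch y 0<y n ⟨
      gauss y 0<y n * poch y (2 ℕ.+ n)   ≈⟨ *-congˡ (poch-cong (sym x≈y) (2 ℕ.+ n)) ⟩
      gauss y 0<y n * poch x (2 ℕ.+ n)   ≈⟨ *-comm _ _ ⟩
      poch x (2 ℕ.+ n) * gauss y 0<y n   ∎
      where open ≈-Reasoning

    -- `Γ` is a bare function of a number and a proof of positivity. That it respects `≈` and
    -- ignores the proof comes from the uniqueness of limits.
    Γ-cong : x ≈ y → ∀ 0<x 0<y → Γ x 0<x ≈ Γ y 0<y
    Γ-cong {x} {y} x≈y 0<x 0<y =
      ⟶-unique (⟶-cong (gauss-cong x≈y 0<x 0<y) (gauss⟶Γ x 0<x)) (gauss⟶Γ y 0<y)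

    gauss-step : ∀ 0<x 0<x+1 n →
      gauss (x + 1#) 0<x+1 n * (x + ι (suc (suc n))) ≈ x * (ι (suc n) * gauss x 0<x n)
    gauss-step {x} 0<x 0<x+1 n = *-cancelˡ (poch-pos 0<x (2 ℕ.+ n)) $ begin
      P * (g′ * (x + ι (2 ℕ.+ n)))
          ≈⟨ solve 3 (λ p g s → p :* (g :* s) := g :* (p :* s)) refl P g′ (x + ι (2 ℕ.+ n)) ⟩
      g′ * poch x (3 ℕ.+ n)                 ≈⟨ *-congˡ (poch-suc x (2 ℕ.+ n)) ⟩
      g′ * (x * P′)
          ≈⟨ solve 3 (λ g x p → g :* (x :* p) := x :* (g :* p)) refl g′ x P′ ⟩
      x * (g′ * P′)                         ≈⟨ *-congˡ (gauss-poch (x + 1#) 0<x+1 n) ⟩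
      x * (F * exp ((x + 1#) * ln n))       ≈⟨ *-congˡ (*-congˡ exp-step) ⟩
      x * (F * (exp (x * ln n) * ι (suc n))) ≈⟨ *-congˡ (sym (*-assoc _ _ _)) ⟩
      x * (F * exp (x * ln n) * ι (suc n))  ≈⟨ *-congˡ (*-congʳ (gauss-poch x 0<x n)) ⟨
      x * (g * P * ι (suc n))
          ≈⟨ solve 4 (λ x g p s → x :* (g :* p :* s) := p :* (x :* (s :* g))) refl x g P
              (ι (suc n)) ⟩
      P * (x * (ι (suc n) * g))             ∎
      where
      open ≈-Reasoning
      P P′ g g′ F : Carrier
      P  = poch x (2 ℕ.+ n)
      P′ = poch (x + 1#) (2 ℕ.+ n)
      g  = gauss x 0<x n
      g′ = gauss (x + 1#) 0<x+1 n
      F  = ι (suc n !)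
      exp-step : exp ((x + 1#) * ln n) ≈ exp (x * ln n) * ι (suc n)
      exp-step = trans (exp-cong (solve 2 (λ x l → (x :+ :1) :* l := x :* l :+ l) refl x (ln n)))
        (trans (exp-+ (x * ln n) (ln n)) (*-congˡ (exp-ln n)))

    -- By `gauss-step` the defect satisfies (n + 1) r = - (x + 1) g′ exactly. Since g′ converges,
    -- the right side is bounded, so r tends to zero.
    Γ-suc : ∀ 0<x 0<x+1 → Γ (x + 1#) 0<x+1 ≈ x * Γ x 0<x
    Γ-suc {x} 0<x 0<x+1 = x-y≈0⇒x≈y _ _ (⟶-unique
      (⟶-+ (gauss⟶Γ (x + 1#) 0<x+1) (⟶-neg (⟶-*ˡ x (gauss⟶Γ x 0<x)))) r⟶0)
      where
      g g′ r : ℕ → Carrier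
      g = gauss x 0<x
      g′ = gauss (x + 1#) 0<x+1
      r n = g′ n - x * g n
      ιr≈ : ∀ n → - (x + 1#) * g′ n ≈ ι (suc n) * r n
      ιr≈ n = begin
        - (x + 1#) * g′ n
          ≈⟨ solve 3 (λ x g n → (:- (x :+ :1)) :* g := n :* g :- g :* (x :+ (:1 :+ n))) refl x
              (g′ n) (ι (suc n)) ⟩
        ι (suc n) * g′ n - g′ n * (x + ι (suc (suc n)))
          ≈⟨ +-congˡ (-‿cong (gauss-step 0<x 0<x+1 n)) ⟩
        ι (suc n) * g′ n - x * (ι (suc n) * g n)
          ≈⟨ solve 4 (λ x g g′ n → n :* g′ :- x :* (n :* g) := n :* (g′ :- x :* g)) refl x (g n)
              (g′ n) (ι (suc n)) ⟩
        ι (suc n) * r n ∎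
        where open ≈-Reasoning
      r⟶0 : r ⟶ 0#
      r⟶0 =
        let C , 0<C , N , bound = ⟶-bounded (⟶-*ˡ (- (x + 1#)) (gauss⟶Γ (x + 1#) 0<x+1))
        -- The factor in `ιr≈` is n + 1 at index n; shifting by `ℕ.pred` makes factor and index
        -- agree.
        in ⟶-suc {s = r ∘ ℕ.pred} (ι-bounded⇒⟶0 (suc N) 0<C λ
             { (suc n) (ℕ.s≤s N≤n) → ∣∣<-resp (ιr≈ n) refl (bound n N≤n) })

    Γ-+ι : ∀ 0<x k 0<x+k → Γ (x + ι k) 0<x+k ≈ poch x k * Γ x 0<x
    Γ-+ι {x} 0<x zero    0<x+0 = trans (Γ-cong (+-identityʳ x) 0<x+0 0<x) (sym (*-identityˡ _))
    Γ-+ι {x} 0<x (suc k) 0<x+k = begin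
      Γ (x + ι (suc k)) 0<x+k          ≈⟨ Γ-cong x+k≈ 0<x+k 0<x+k+1 ⟩
      Γ (x + ι k + 1#) 0<x+k+1         ≈⟨ Γ-suc (0<x+ι 0<x k) 0<x+k+1 ⟩
      (x + ι k) * Γ (x + ι k) (0<x+ι 0<x k) ≈⟨ *-congˡ (Γ-+ι 0<x k (0<x+ι 0<x k)) ⟩
      (x + ι k) * (poch x k * Γ x 0<x)
          ≈⟨ solve 3 (λ s p g → s :* (p :* g) := p :* s :* g) refl (x + ι k) (poch x k) (Γ x 0<x) ⟩
      poch x (suc k) * Γ x 0<x         ∎
      where
      open ≈-Reasoning
      x+k≈ : x + ι (suc k) ≈ x + ι k + 1#
      x+k≈ = solve 2 (λ x k → x :+ (:1 :+ k) := x :+ k :+ :1) refl x (ι k)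
      0<x+k+1 : 0# < x + ι k + 1#
      0<x+k+1 = +-pos (0<x+ι 0<x k) 0<1

    -- With d the difference of the logarithms, e^d = (n + 2) / (n + 1), so (1 - d) e^d ≤ 1 reads (1
    -- - d) (n + 2) ≤ n + 1.
    1≤ι*Δln : ∀ n → 1# ≤ ι (suc (suc n)) * (ln (suc n) - ln n)
    1≤ι*Δln n = 0≤-⇒≤
      (solve 2 (λ d k → (:1 :+ k) :* d :- :1 := k :- (:1 :- d) :* (:1 :+ k)) refl d (ι (suc n)))
      (≤⇒0≤- (≤-resp (trans (*-assoc _ _ _) (*-congˡ exp-d)) (*-identityˡ _)
        (*-mono-≤′ (exp-geometric 0≤d))))
      where
      d : Carrier
      d = ln (suc n) - ln n
      0≤d : 0# ≤ d
      0≤d = ≤⇒0≤- (exp-cancel-≤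
          (≤-resp (sym (exp-ln n)) (sym (exp-ln (suc n))) (ι-mono-≤ (ℕ.n≤1+n (suc n)))))
      exp-d : exp d * ι (suc n) ≈ ι (suc (suc n))
      exp-d = trans (*-congˡ (sym (exp-ln n))) (trans (sym (exp-+ d (ln n)))
        (trans (exp-cong (solve 2 (λ a b → a :- b :+ b := a) refl (ln (suc n)) (ln n)))
            (exp-ln (suc n))))
      *-mono-≤′ : ∀ {a b} → a ≤ b → a * ι (suc n) ≤ b * ι (suc n)
      *-mono-≤′ {a} {b} a≤b = 0≤-⇒≤
        (solve 3 (λ a b k → b :* k :- a :* k := (b :- a) :* k) refl a b (ι (suc n)))
        (*-nonneg (≤⇒0≤- a≤b) (0≤ι (suc n)))

    gauss-ratio : ∀ 0<x n → gauss x 0<x (suc n) * (x + ι (suc (suc n)))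
                          ≈ ι (suc (suc n)) * exp (x * (ln (suc n) - ln n)) * gauss x 0<x n
    gauss-ratio {x} 0<x n = *-cancelˡ (poch-pos 0<x (2 ℕ.+ n)) $ begin
      P * (g′ * s)              ≈⟨ solve 3 (λ p g s → p :* (g :* s) := g :* (p :* s)) refl P g′ s ⟩
      g′ * poch x (3 ℕ.+ n)     ≈⟨ gauss-poch x 0<x (suc n) ⟩
      ι (suc (suc n) !) * exp (x * ln (suc n))
                                ≈⟨ *-cong (ι-* (suc (suc n)) (suc n !)) exp-step ⟩
      (k * F) * (e * exp (x * ln n))
                                ≈⟨ solve 4 (λ k f e l → (k :* f) :* (e :* l) := k :* e :* (f :* l))
                                    refl k F e (exp (x * ln n)) ⟩
      k * e * (F * exp (x * ln n)) ≈⟨ *-congˡ (gauss-poch x 0<x n) ⟨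
      k * e * (g * P)
          ≈⟨ solve 4 (λ k e g p → k :* e :* (g :* p) := p :* (k :* e :* g)) refl k e g P ⟩
      P * (k * e * g)           ∎
      where
      open ≈-Reasoning
      P g g′ s F k e : Carrier
      P  = poch x (2 ℕ.+ n)
      g  = gauss x 0<x n
      g′ = gauss x 0<x (suc n)
      s  = x + ι (suc (suc n))
      F  = ι (suc n !)
      k  = ι (suc (suc n))
      e  = exp (x * (ln (suc n) - ln n))
      exp-step : exp (x * ln (suc n)) ≈ e * exp (x * ln n)
      exp-step = trans (exp-cong
          (solve 3 (λ x a b → x :* a := x :* (a :- b) :+ x :* b) refl x (ln (suc n)) (ln n)))
        (exp-+ _ _)

    gauss-pos : ∀ 0<x n → 0# < gauss x 0<x n
    gauss-pos {x} 0<x n = pos-cancelˡ (poch-pos 0<x (2 ℕ.+ n))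
      (<-respʳ-≈ (trans (sym (gauss-poch x 0<x n)) (*-comm _ _))
        (*-pos (0<ι (suc n !) {{ℕ._!≢0 (suc n)}}) (exp-pos (x * ln n))))

    -- exp (x d) ≥ 1 + x d with d = log (n + 2) - log (n + 1) ≥ 1 / (n + 2).
    gauss-increasing : ∀ 0<x n → gauss x 0<x n ≤ gauss x 0<x (suc n)
    gauss-increasing {x} 0<x n = *-cancelˡ-≤ (0<x+ι 0<x (2 ℕ.+ n)) $
      ≤-resp refl (trans (sym (gauss-ratio 0<x n)) (*-comm _ _)) $
        *-mono-≤ (<⇒≤ (0<x+ι 0<x (2 ℕ.+ n))) x+k≤ (<⇒≤ (gauss-pos 0<x n)) ≤-refl
      where
      k d : Carrier
      k = ι (2 ℕ.+ n)
      d = ln (suc n) - ln n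
      0≤d : 0# ≤ d
      0≤d = nonneg-cancelˡ (0<ι-suc (suc n)) (≤-trans 0≤1 (1≤ι*Δln n))
      x+k≤ : x + k ≤ k * exp (x * d)
      x+k≤ = ≤-trans
        (0≤-⇒≤ (solve 3 (λ x k d → k :* (:1 :+ x :* d) :- (x :+ k) := x :* (k :* d :- :1)) refl x k
            d)
          (*-nonneg (<⇒≤ 0<x) (≤⇒0≤- (1≤ι*Δln n))))
        (*-mono-≤ (0≤ι (2 ℕ.+ n)) ≤-refl (+-nonneg 0≤1 (*-nonneg (<⇒≤ 0<x) 0≤d))
            (exp-≥ (*-nonneg (<⇒≤ 0<x) 0≤d)))

    -- A limit of positive numbers is only nonnegative; monotonicity supplies the fixed positive
    -- lower bound, the first approximant.
    Γ-pos : ∀ x 0<x → 0# < Γ x 0<x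
    Γ-pos x 0<x = <-≤-trans (gauss-pos 0<x 0) (⟶-≥ 0 (λ n _ → from-0 n) (gauss⟶Γ x 0<x))
      where
      from-0 : ∀ n → gauss x 0<x 0 ≤ gauss x 0<x n
      from-0 zero    = ≤-refl
      from-0 (suc n) = ≤-trans (from-0 n) (gauss-increasing 0<x n)

    abstract
      Γ#0 : ∀ x 0<x → Γ x 0<x # 0#
      Γ#0 x 0<x = 0<⇒#0 (Γ-pos x 0<x)

-- Determinants by expansion along the first row

-- Deleting a third column leaves two neighbours adjacent, so equal neighbouring columns persist in
-- that minor.
punchIn-adjacent : ∀ {n} (p : Fin (suc n)) j → j ≢ inject₁ p → j ≢ suc p →
  ∃[ q ] punchIn j (inject₁ q) ≡ inject₁ p × punchIn j (suc q) ≡ suc p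
punchIn-adjacent         zero    zero          j≢p _    = contradiction ≡.refl j≢p
punchIn-adjacent         (suc p) zero          _   _    = p , ≡.refl , ≡.refl
punchIn-adjacent         zero    (suc zero)    _   j≢p′ = contradiction ≡.refl j≢p′
punchIn-adjacent {suc n} zero    (suc (suc j)) _   _    = zero , ≡.refl , ≡.refl
punchIn-adjacent {suc n} (suc p) (suc j)       j≢p j≢p′ =
  let q , eq , eq′ = punchIn-adjacent p j (j≢p ∘ ≡.cong suc) (j≢p′ ∘ ≡.cong suc)
  in suc q , ≡.cong suc eq , ≡.cong suc eq′

-- The minors that delete one of two neighbouring columns agree except at the single place where
-- each keeps the other one of the two.
punchIn-inject₁-suc : ∀ {n} (p : Fin n) k →
  punchIn (inject₁ p) k ≡ punchIn (suc p) k ⊎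
  punchIn (inject₁ p) k ≡ suc p × punchIn (suc p) k ≡ inject₁ p
punchIn-inject₁-suc zero    zero    = inj₂ (≡.refl , ≡.refl)
punchIn-inject₁-suc zero    (suc k) = inj₁ ≡.refl
punchIn-inject₁-suc (suc p) zero    = inj₁ ≡.refl
punchIn-inject₁-suc (suc p) (suc k) with punchIn-inject₁-suc p k
... | inj₁ eq         = inj₁ (≡.cong suc eq)
... | inj₂ (eq , eq′) = inj₂ (≡.cong suc eq , ≡.cong suc eq′)

punchIn-fromℕ : ∀ {n} (k : Fin n) → punchIn (fromℕ n) k ≡ inject₁ k
punchIn-fromℕ zero    = ≡.refl
punchIn-fromℕ (suc k) = ≡.cong suc (punchIn-fromℕ k)

module Determinant {c ℓ₁ ℓ₂ ℓ₃} (ℝ : RealNumbers c ℓ₁ ℓ₂ ℓ₃) where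

  open OrderedField ℝ
  -- The sum of the multiplicative monoid: `Product.sum` is a product.
  module Product = Algebra.Properties.CommutativeMonoid.Sum *-commutativeMonoid

  Matrix : ℕ → Set c
  Matrix n = Vector (Vector Carrier n) n

  minor : ∀ {n} → Matrix (suc n) → Fin (suc n) → Matrix n
  minor A j i k = A (suc i) (punchIn j k)

  sign : ∀ {n} → Fin n → Carrier
  sign j = (- 1#) ^ toℕ j

  term : ∀ {n} → Matrix (suc n) → Fin (suc n) → Carrier
  term A j = sign j * A zero j * det (minor A j)

  det-cong : ∀ {n} {A B : Matrix n} → (∀ i j → A i j ≈ B i j) → det A ≈ det B
  det-cong {zero}  A≈B = refl
  det-cong {suc n} {A} {B} A≈B = Sum.sum-cong-≋ {x = term A} {term B} λ j →
    *-cong (*-congˡ {sign j} (A≈B zero j)) (det-cong λ i k → A≈B (suc i) (punchIn j k))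

  -- The term j = p is linear through its entry, since its minor omits column `p`; every other term
  -- is linear through its minor, by induction.
  det-linear : ∀ {n} (A B C : Matrix n) a p → (∀ i → A i p ≈ B i p + a * C i p) →
    (∀ i j → j ≢ p → A i j ≈ B i j) → (∀ i j → j ≢ p → A i j ≈ C i j) →
    det A ≈ det B + a * det C
  det-linear {suc n} A B C a p Aₚ A≈B A≈C = begin
    sum (term A)                            ≈⟨ Sum.sum-cong-≋ termwise ⟩
    sum (λ j → term B j + a * term C j)     ≈⟨ Sum.∑-distrib-+ (term B) (λ j → a * term C j) ⟩
    sum (term B) + sum (λ j → a * term C j) ≈⟨ +-congˡ (Sum.*-distribˡ-sum a (term C)) ⟨
    sum (term B) + a * sum (term C)         ∎
    where
    open ≈-Reasoning
    termwise : ∀ j → term A j ≈ term B j + a * term C j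
    termwise j with j Fin.≟ p
    ... | yes ≡.refl = begin
      sign j * A zero j * det (minor A j)
        ≈⟨ *-congʳ (*-congˡ (Aₚ zero)) ⟩
      sign j * (B zero j + a * C zero j) * det (minor A j)
        ≈⟨ solve 5 (λ s b a c d → s :* (b :+ a :* c) :* d := s :* b :* d :+ a :* (s :* c :* d)) refl
             (sign j) (B zero j) a (C zero j) (det (minor A j)) ⟩
      sign j * B zero j * det (minor A j) + a * (sign j * C zero j * det (minor A j))
        ≈⟨ +-cong
             (*-congˡ (det-cong λ i k → A≈B (suc i) (punchIn j k) (Fin.punchInᵢ≢i j k)))
             (*-congˡ (*-congˡ (det-cong λ i k → A≈C (suc i) (punchIn j k) (Fin.punchInᵢ≢i j k)))) ⟩
      term B j + a * term C j ∎
    ... | no j≢p = begin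
      sign j * A zero j * det (minor A j)
        ≈⟨ *-congˡ (det-linear (minor A j) (minor B j) (minor C j) a q column
             (λ i k k≢q → A≈B (suc i) (punchIn j k) (k≢q ∘ off-q))
             (λ i k k≢q → A≈C (suc i) (punchIn j k) (k≢q ∘ off-q))) ⟩
      sign j * A zero j * (det (minor B j) + a * det (minor C j))
        ≈⟨ solve 5 (λ s b d a e → s :* b :* (d :+ a :* e) := s :* b :* d :+ a :* (s :* b :* e)) refl
             (sign j) (A zero j) (det (minor B j)) a (det (minor C j)) ⟩
      sign j * A zero j * det (minor B j) + a * (sign j * A zero j * det (minor C j))
        ≈⟨ +-cong (*-congʳ (*-congˡ (A≈B zero j j≢p)))
            (*-congˡ (*-congʳ (*-congˡ (A≈C zero j j≢p)))) ⟩
      term B j + a * term C j ∎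
      where
      q : Fin n
      q = punchOut j≢p
      in-q : punchIn j q ≡ p
      in-q = Fin.punchIn-punchOut j≢p
      off-q : ∀ {k} → punchIn j k ≡ p → k ≡ q
      off-q eq = Fin.punchIn-injective j _ _ (≡.trans eq (≡.sym in-q))
      column : ∀ i → minor A j i q ≈ minor B j i q + a * minor C j i q
      column i rewrite in-q = Aₚ (suc i)

  sum-zero : ∀ {n} (f : Vector Carrier n) → (∀ i → f i ≈ 0#) → sum f ≈ 0#
  sum-zero {n} f f≈0 = trans (Sum.sum-cong-≋ f≈0) (Sum.sum-replicate-zero n)

  sum-adjacent : ∀ {n} (f : Vector Carrier (suc n)) p →
    (∀ j → j ≢ inject₁ p → j ≢ suc p → f j ≈ 0#) → f (inject₁ p) + f (suc p) ≈ 0# → sum f ≈ 0#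
  sum-adjacent f zero    f≈0 f+f≈0 = trans
    (+-congˡ (+-congˡ (sum-zero (λ j → f (suc (suc j))) (λ j → f≈0 (suc (suc j)) (λ ()) (λ ())))))
    (trans (+-congˡ (+-identityʳ _)) f+f≈0)
  sum-adjacent f (suc p) f≈0 f+f≈0 = trans
    (+-cong (f≈0 zero (λ ()) (λ ()))
      (sum-adjacent (f ∘ suc) p
        (λ j j≢p j≢p′ → f≈0 (suc j) (j≢p ∘ Fin.suc-injective) (j≢p′ ∘ Fin.suc-injective)) f+f≈0))
    (+-identityˡ 0#)

  -- The minors that still contain both equal columns vanish by induction. The two remaining terms
  -- have equal entries, equal minors and opposite signs.
  det-adjacent : ∀ {n} (A : Matrix (suc n)) p → (∀ i → A i (inject₁ p) ≈ A i (suc p)) → det A ≈ 0#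
  det-adjacent {suc n} A p Aₚ≈ = sum-adjacent (term A) p
    (λ j j≢p j≢p′ →
      let q , eq , eq′ = punchIn-adjacent p j j≢p j≢p′
      in trans (*-congˡ {sign j * A zero j} (det-adjacent (minor A j) q λ i →
           ≡.subst₂ (λ k k′ → A (suc i) k ≈ A (suc i) k′) (≡.sym eq) (≡.sym eq′) (Aₚ≈ (suc i))))
         (zeroʳ _))
    (begin
      (- 1#) ^ toℕ (inject₁ p) * A zero (inject₁ p) * det (minor A (inject₁ p))
        + - 1# * (- 1#) ^ toℕ p * A zero (suc p) * det (minor A (suc p))
        ≈⟨ +-congʳ (*-cong (*-cong (reflexive (≡.cong ((- 1#) ^_) (Fin.toℕ-inject₁ p))) (Aₚ≈ zero))
                           (det-cong minor≈)) ⟩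
      (- 1#) ^ toℕ p * A zero (suc p) * det (minor A (suc p))
        + - 1# * (- 1#) ^ toℕ p * A zero (suc p) * det (minor A (suc p))
        ≈⟨ solve 3 (λ s a d → s :* a :* d :+ (:- :1) :* s :* a :* d := :0) refl
             ((- 1#) ^ toℕ p) (A zero (suc p)) (det (minor A (suc p))) ⟩
      0# ∎)
    where
    open ≈-Reasoning
    minor≈ : ∀ i k → minor A (inject₁ p) i k ≈ minor A (suc p) i k
    minor≈ i k = [ (λ eq → reflexive (≡.cong (A (suc i)) eq))
                 , (λ (eq , eq′) → ≡.subst₂ (λ k k′ → A (suc i) k ≈ A (suc i) k′) (≡.sym eq)
                     (≡.sym eq′) (sym (Aₚ≈ (suc i)))) ]′
                 (punchIn-inject₁-suc p k)

  det-scale : ∀ {n} (r c : Vector Carrier n) (A : Matrix n) →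
    det (λ i j → r i * (c j * A i j)) ≈ Product.sum r * Product.sum c * det A
  det-scale {zero}  r c A = sym (trans (*-congʳ (*-identityˡ 1#)) (*-identityˡ 1#))
  det-scale {suc n} r c A = trans (Sum.sum-cong-≋ termwise)
    (sym (Sum.*-distribˡ-sum (Product.sum r * Product.sum c) (term A)))
    where
    open ≈-Reasoning
    termwise : ∀ j → (- 1#) ^ toℕ j * (r zero * (c j * A zero j))
                       * det (λ i k → r (suc i) * (c (punchIn j k) * minor A j i k))
                   ≈ Product.sum r * Product.sum c * ((- 1#) ^ toℕ j * A zero j * det (minor A j))
    termwise j = begin
      s * (r zero * (c j * A zero j)) * det (λ i k → r (suc i) * (c (punchIn j k) * minor A j i k))
        ≈⟨ *-congˡ (det-scale (r ∘ suc) (c ∘ punchIn j) (minor A j)) ⟩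
      s * (r zero * (c j * A zero j)) * (R * C * det (minor A j))
        ≈⟨ solve 7 (λ s r c a R C d → s :* (r :* (c :* a)) :* (R :* C :* d)
                      := r :* R :* (c :* C) :* (s :* a :* d)) refl
             s (r zero) (c j) (A zero j) R C (det (minor A j)) ⟩
      r zero * R * (c j * C) * (s * A zero j * det (minor A j))
        -- The minor lacks the factor of column `j`; the entry in front of it brings that factor
        -- back.
        ≈⟨ *-congʳ (*-congˡ (Product.sum-remove {i = j} c)) ⟨
      Product.sum r * Product.sum c * (s * A zero j * det (minor A j)) ∎
      where
      s R C : Carrier
      s = (- 1#) ^ toℕ j
      R = Product.sum (r ∘ suc)
      C = Product.sum (c ∘ punchIn j)

  det-last : ∀ {n} (A : Matrix (suc n)) → (∀ j → A zero (inject₁ j) ≈ 0#) →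
    det A ≈ (- 1#) ^ n * A zero (fromℕ n) * det (λ i j → A (suc i) (inject₁ j))
  det-last {n} A A₀≈0 = begin
    det A
      ≈⟨ Sum.sum-init-last (term A) ⟩
    sum (term A ∘ inject₁) + term A (fromℕ n)
      ≈⟨ +-congʳ (sum-zero (term A ∘ inject₁)
          (λ j → trans (*-congʳ (trans (*-congˡ (A₀≈0 j)) (zeroʳ _))) (zeroˡ _))) ⟩
    0# + term A (fromℕ n)
      ≈⟨ +-identityˡ _ ⟩
    (- 1#) ^ toℕ (fromℕ n) * A zero (fromℕ n) * det (minor A (fromℕ n))
      ≈⟨ *-cong (*-congʳ (reflexive (≡.cong ((- 1#) ^_) (Fin.toℕ-fromℕ n))))
           (det-cong λ i k → reflexive (≡.cong (A (suc i)) (punchIn-fromℕ k))) ⟩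
    (- 1#) ^ n * A zero (fromℕ n) * det (λ i j → A (suc i) (inject₁ j)) ∎
    where open ≈-Reasoning

-- Decreasing degrees and the order of column expansions

Decreasing : ∀ {n} → (Fin (suc n) → ℕ) → Set
Decreasing k = ∀ i → k (suc i) ℕ.< k (inject₁ i)

decreasing⇒last≤ : ∀ {n} (k : Fin (suc n) → ℕ) → Decreasing k → ∀ i → k (fromℕ n) ℕ.≤ k i
decreasing⇒last≤ k k↓ = >-weakInduction (λ i → k (fromℕ _) ℕ.≤ k i) ℕ.≤-refl
  (λ i last≤ → ℕ.≤-trans last≤ (ℕ.<⇒≤ (k↓ i)))

decreasing⇒≤first : ∀ {n} (k : Fin (suc n) → ℕ) → Decreasing k → ∀ i → k i ℕ.≤ k zero
decreasing⇒≤first k k↓ = <-weakInduction (λ i → k i ℕ.≤ k zero) ℕ.≤-refl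
  (λ i ≤first → ℕ.≤-trans (ℕ.<⇒≤ (k↓ i)) ≤first)

decreasing-updateAt : ∀ {n} (k : Fin (suc n) → ℕ) → Decreasing k → ∀ p q →
  k (suc p) ℕ.< q → q ℕ.< k (inject₁ p) → Decreasing (updateAt k (inject₁ p) (const q))
decreasing-updateAt k k↓ p q next<q q<old i with inject₁ i Fin.≟ inject₁ p | suc i Fin.≟ inject₁ p
... | yes i≡p | _
  rewrite Fin.inject₁-injective i≡p
        | updateAt-updates (inject₁ p) {const q} k
        | updateAt-minimal (suc p) (inject₁ p) {const q} k
            (λ eq → ℕ.1+n≢n (≡.trans (≡.cong toℕ eq) (Fin.toℕ-inject₁ p)))
  = next<q
... | no i≢p | yes 1+i≡p
  rewrite 1+i≡p
        | updateAt-updates (inject₁ p) {const q} k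
        | updateAt-minimal (inject₁ i) (inject₁ p) {const q} k i≢p
  = ℕ.<-trans q<old (≡.subst (λ j → k j ℕ.< k (inject₁ i)) 1+i≡p (k↓ i))
... | no i≢p | no 1+i≢p
  rewrite updateAt-minimal (suc i) (inject₁ p) {const q} k 1+i≢p
        | updateAt-minimal (inject₁ i) (inject₁ p) {const q} k i≢p
  = k↓ i

-- The numbers t of nodes used in the columns j when p columns are still to be
-- expanded.
stage : ℕ → ℕ → ℕ → ℕ
stage t zero    j       = t
stage t (suc p) zero    = suc t
stage t (suc p) (suc j) = stage t p j

stage-≥ : ∀ t {p j} → p ℕ.≤ j → stage t p j ≡ t
stage-≥ t ℕ.z≤n       = ≡.refl
stage-≥ t (ℕ.s≤s p≤j) = stage-≥ t p≤j

stage-< : ∀ t {p j} → j ℕ.< p → stage t p j ≡ suc t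
stage-< t {suc p} {zero}  _           = ≡.refl
stage-< t {suc p} {suc j} (ℕ.s≤s j<p) = stage-< t j<p

stage-suc : ∀ t p j → j ≢ p → stage t (suc p) j ≡ stage t p j
stage-suc t zero    zero    0≢0 = contradiction ≡.refl 0≢0
stage-suc t zero    (suc j) _   = ≡.refl
stage-suc t (suc p) zero    _   = ≡.refl
stage-suc t (suc p) (suc j) j≢p = stage-suc t p j (j≢p ∘ ≡.cong suc)

-- Positivity of Newton determinants

module NewtonPositivity {c ℓ₁ ℓ₂ ℓ₃} (ℝ : RealNumbers c ℓ₁ ℓ₂ ℓ₃) where

  open OrderedField ℝ
  open Determinant ℝ

  newton : (ℕ → Carrier) → ℕ → Carrier → Carrier
  newton a zero    x = 1#
  newton a (suc k) x = (x + a 0) * newton (a ∘ suc) k x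

  -- The Newton polynomial whose nodes from index `t` on are replaced by zero: a monomial for t = 0,
  -- the full Newton polynomial for t ≥ k.
  mixed : (ℕ → Carrier) → ℕ → ℕ → Carrier → Carrier
  mixed a t       zero    x = 1#
  mixed a zero    (suc k) x = x * mixed a zero k x
  mixed a (suc t) (suc k) x = (x + a 0) * mixed (a ∘ suc) t k x

  newton-cong : ∀ {a b x y} k → (∀ l → x + a l ≈ y + b l) → newton a k x ≈ newton b k y
  newton-cong zero    _    = refl
  newton-cong (suc k) x+a≈ = *-cong (x+a≈ 0) (newton-cong k (x+a≈ ∘ suc))

  newton-0 : ∀ k x → newton (λ _ → 0#) k x ≈ x ^ k
  newton-0 zero    x = refl
  newton-0 (suc k) x = *-cong (+-identityʳ x) (newton-0 k x)

  mixed-0 : ∀ a k x → mixed a 0 k x ≡ x ^ k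
  mixed-0 a zero    x = ≡.refl
  mixed-0 a (suc k) x = ≡.cong (x *_) (mixed-0 a k x)

  mixed-newton : ∀ a {t k} x → k ℕ.≤ t → mixed a t k x ≡ newton a k x
  mixed-newton a         {k = zero} x _           = ≡.refl
  mixed-newton a {suc t}            x (ℕ.s≤s k≤t) = ≡.cong ((x + a 0) *_)
      (mixed-newton (a ∘ suc) x k≤t)

  -- The two polynomials of degree k + 1 differ in one factor, x + a t against x; splitting off a t
  -- leaves the product of the other k factors.
  mixed-suc : ∀ a {t k} x → t ℕ.≤ k →
    mixed a (suc t) (suc k) x ≈ mixed a t (suc k) x + a t * mixed a t k x
  mixed-suc a {zero} {k} x _ = trans
    (*-congˡ (reflexive (≡.trans (mixed-0 (a ∘ suc) k x) (≡.sym (mixed-0 a k x))))) (distribʳ _ _ _)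
  mixed-suc a {suc t} {suc k} x (ℕ.s≤s t≤k) = trans (*-congˡ (mixed-suc (a ∘ suc) x t≤k))
    (solve 4 (λ u v a w → u :* (v :+ a :* w) := u :* v :+ a :* (u :* w)) refl
      (x + a 0) (mixed (a ∘ suc) t (suc k) x) (a (suc t)) (mixed (a ∘ suc) t k x))

  -- The sign of the permutation of n letters that reverses their order.
  reversalSign : ℕ → Carrier
  reversalSign zero    = 1#
  reversalSign (suc n) = (- 1#) ^ n * reversalSign n

  -- Increasing points against decreasing degrees give a generalised Vandermonde matrix with its
  -- columns reversed; the sign compensates for the reversal.
  signedDet : ∀ {n} → Matrix n → Carrier
  signedDet {n} A = reversalSign n * det A

  signedDet-cong : ∀ {n} {A B : Matrix n} → (∀ i j → A i j ≈ B i j) → signedDet A ≈ signedDet B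
  signedDet-cong A≈B = *-congˡ (det-cong A≈B)

  module _ {n} (x : Fin (suc n) → Carrier) (a : ℕ → Carrier) (0<a : ∀ l → 0# < a l) where

    mixedMatrix : (τ k : Fin (suc n) → ℕ) → Matrix (suc n)
    mixedMatrix τ k i j = mixed a (τ j) (k j) (x i)

    -- All degree sequences are treated at once, because expanding a column lowers one of the
    -- degrees.
    Positive : (Fin (suc n) → ℕ) → Set ℓ₃
    Positive τ = ∀ k → Decreasing k → k (fromℕ n) ≡ 0 → 0# < signedDet (mixedMatrix τ k)

    positive-cong : ∀ {τ τ′} → (∀ j → τ j ≡ τ′ j) → Positive τ → Positive τ′
    positive-cong τ≡ pos k k↓ k₀ = <-respʳ-≈
      (signedDet-cong λ i j → reflexive (≡.cong (λ t → mixed a t (k j) (x i)) (τ≡ j)))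
      (pos k k↓ k₀)

    -- Expanding column p by mixed-suc writes the determinant as a positive one
    -- plus a positive multiple of one that is positive or has two equal columns.
    positive-step : ∀ {τ τ′ : Fin (suc n) → ℕ} t p → τ p ≡ t → τ′ p ≡ suc t →
      (∀ j → j ≢ p → τ j ≡ τ′ j) → (∀ i → p ≡ inject₁ i → τ (suc i) ≡ t) →
      Positive τ → Positive τ′
    positive-step {τ} {τ′} t p τₚ τ′ₚ τ≡τ′ τ-next pos k k↓ k₀ = by-degree (k p) ≡.refl
      where
      off-p : ∀ i j → j ≢ p → mixedMatrix τ′ k i j ≈ mixedMatrix τ k i j
      off-p i j j≢p = reflexive (≡.cong (λ t → mixed a t (k j) (x i)) (≡.sym (τ≡τ′ j j≢p)))

      unchanged : k p ℕ.≤ t → ∀ i j → mixedMatrix τ k i j ≈ mixedMatrix τ′ k i j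
      unchanged kₚ≤t i j with j Fin.≟ p
      ... | no  j≢p    = sym (off-p i j j≢p)
      ... | yes ≡.refl = reflexive (≡.trans
        (mixed-newton a (x i) (≡.subst (k p ℕ.≤_) (≡.sym τₚ) kₚ≤t))
        (≡.sym (mixed-newton a (x i) (≡.subst (k p ℕ.≤_) (≡.sym τ′ₚ) (ℕ.m≤n⇒m≤1+n kₚ≤t)))))

      module _ (q : ℕ) (kₚ : k p ≡ suc q) (t≤q : t ℕ.≤ q) where

        k′ : Fin (suc n) → ℕ
        k′ = updateAt k p (const q)

        k′ₚ : k′ p ≡ q
        k′ₚ = updateAt-updates p k

        k′-other : ∀ j → j ≢ p → k′ j ≡ k j
        k′-other j j≢p = updateAt-minimal j p k j≢p

        column : ∀ {τ₁ τ₂ k₁ k₂} i → τ₁ ≡ suc t → τ₂ ≡ t → k₁ ≡ suc q → k₂ ≡ q →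
          mixed a τ₁ k₁ (x i) ≈ mixed a τ₂ k₁ (x i) + a t * mixed a τ₂ k₂ (x i)
        column i ≡.refl ≡.refl ≡.refl ≡.refl = mixed-suc a (x i) t≤q

        expansion : signedDet (mixedMatrix τ′ k)
                  ≈ signedDet (mixedMatrix τ k) + a t * signedDet (mixedMatrix τ k′)
        expansion = trans
          (*-congˡ (det-linear (mixedMatrix τ′ k) (mixedMatrix τ k) (mixedMatrix τ k′) (a t) p
            (λ i → column i τ′ₚ τₚ kₚ k′ₚ) off-p
            (λ i j j≢p → trans (off-p i j j≢p)
              (reflexive (≡.cong (λ l → mixed a (τ j) l (x i)) (≡.sym (k′-other j j≢p)))))))
          (solve 4 (λ s d a e → s :* (d :+ a :* e) := s :* d :+ a :* (s :* e)) refl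
            (reversalSign (suc n)) (det (mixedMatrix τ k)) (a t) (det (mixedMatrix τ k′)))

        second-nonneg : ∀ r → p ≡ inject₁ r → 0# ≤ signedDet (mixedMatrix τ k′)
        second-nonneg r ≡.refl =
          [ (λ next<q → <⇒≤ (pos k′
              (decreasing-updateAt k k↓ r q next<q (ℕ.≤-reflexive (≡.sym kₚ))) k′₀))
          , (λ next≡q → ≤-reflexive
              (sym (trans (*-congˡ (det-adjacent (mixedMatrix τ k′) r (equal next≡q))) (zeroʳ _))))
          ]′ (ℕ.m≤n⇒m<n∨m≡n (ℕ.s≤s⁻¹ (≡.subst (k (suc r) ℕ.<_) kₚ (k↓ r))))
          where
          k′₀ : k′ (fromℕ n) ≡ 0
          k′₀ = ≡.trans (k′-other (fromℕ n) (Fin.fromℕ≢inject₁ {n = n})) k₀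
          next≢p : suc r ≢ inject₁ r
          next≢p eq = ℕ.1+n≢n (≡.trans (≡.cong toℕ eq) (Fin.toℕ-inject₁ r))
          equal : k (suc r) ≡ q → ∀ i → mixedMatrix τ k′ i (inject₁ r) ≈ mixedMatrix τ k′ i (suc r)
          -- `τ-next` enters here: equal degrees give equal columns only if the right neighbour also
          -- uses `t` nodes.
          equal next≡q i = reflexive (≡.cong₂ (λ t l → mixed a t l (x i))
            (≡.trans τₚ (≡.sym (τ-next r ≡.refl)))
            (≡.trans k′ₚ (≡.sym (≡.trans (k′-other (suc r) next≢p) next≡q))))

        lowered : 0# < signedDet (mixedMatrix τ′ k)
        lowered with view p
        -- The last column has degree zero, while here the degree of column `p` is a successor.
        ... | ‵fromℕ     = contradiction (≡.trans (≡.sym kₚ) k₀) λ ()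
        ... | ‵inject₁ r = <-respʳ-≈ (sym expansion)
          (+-pos-nonneg (pos k k↓ k₀) (*-nonneg (<⇒≤ (0<a t)) (second-nonneg r ≡.refl)))

      -- A polynomial of degree at most `t` does not reach the node of index `t`, so the matrix is
      -- unchanged; in higher degree the column is expanded.
      by-degree : ∀ m → k p ≡ m → 0# < signedDet (mixedMatrix τ′ k)
      by-degree zero    kₚ = <-respʳ-≈
          (signedDet-cong (unchanged (≡.subst (ℕ._≤ t) (≡.sym kₚ) ℕ.z≤n))) (pos k k↓ k₀)
      by-degree (suc q) kₚ = [ (λ t≤q → lowered q kₚ t≤q)
        , (λ q<t → <-respʳ-≈ (signedDet-cong (unchanged (≡.subst (ℕ._≤ t) (≡.sym kₚ) q<t)))
            (pos k k↓ k₀))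
        ]′ (ℕ.≤-<-connex t q)

    -- The columns are treated from the right, i.e. in order of increasing degree.
    positive-suc : ∀ t → Positive (λ _ → t) → Positive (λ _ → suc t)
    positive-suc t pos = positive-cong (λ j → stage-< t (Fin.toℕ<n j)) (prefix (suc n) ℕ.≤-refl)
      where
      prefix : ∀ p → p ℕ.≤ suc n → Positive (λ j → stage t p (toℕ j))
      prefix zero    _   = pos
      prefix (suc p) p<n = positive-step t (fromℕ< p<n)
        (stage-≥ t (ℕ.≤-reflexive (≡.sym toℕ-p))) (stage-< t (ℕ.s≤s (ℕ.≤-reflexive toℕ-p)))
        (λ j j≢p → ≡.sym (stage-suc t p (toℕ j) λ eq → j≢p
            (Fin.toℕ-injective (≡.trans eq (≡.sym toℕ-p)))))
        (λ i p≡i → stage-≥ t (ℕ.m≤n⇒m≤1+n (ℕ.≤-reflexive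
          (≡.trans (≡.sym toℕ-p) (≡.trans (≡.cong toℕ p≡i) (Fin.toℕ-inject₁ i))))))
        (prefix p (ℕ.<⇒≤ p<n))
        where
        toℕ-p : toℕ (fromℕ< p<n) ≡ p
        toℕ-p = Fin.toℕ-fromℕ< p<n

    positive-all : Positive (λ _ → 0) → ∀ t → Positive (λ _ → t)
    positive-all pos zero    = pos
    positive-all pos (suc t) = positive-suc t (positive-all pos t)

  product-pos : ∀ {n} (r : Vector Carrier n) → (∀ i → 0# < r i) → 0# < Product.sum r
  product-pos {zero}  r 0<r = 0<1
  product-pos {suc n} r 0<r = *-pos (0<r zero) (product-pos (r ∘ suc) (0<r ∘ suc))

  signedDet-rows : ∀ {n} (r : Vector Carrier n) (A : Matrix n) →
    signedDet (λ i j → r i * A i j) ≈ Product.sum r * signedDet A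
  signedDet-rows {n} r A = begin
    κ * det (λ i j → r i * A i j)
      ≈⟨ *-congˡ (det-cong λ i j → *-congˡ (*-identityˡ (A i j))) ⟨
    κ * det (λ i j → r i * (1# * A i j))
      ≈⟨ *-congˡ (det-scale r (λ _ → 1#) A) ⟩
    κ * (Product.sum r * Product.sum {n} (λ _ → 1#) * det A)
      ≈⟨ *-congˡ (*-congʳ (*-congˡ (Product.sum-replicate-zero n))) ⟩
    κ * (Product.sum r * 1# * det A)
      ≈⟨ solve 3 (λ κ r d → κ :* (r :* :1 :* d) := r :* (κ :* d)) refl κ (Product.sum r) (det A) ⟩
    Product.sum r * (κ * det A) ∎
    where
    open ≈-Reasoning
    κ : Carrier
    κ = reversalSign n

  -- The cofactor sign of the last column is the very factor by which `reversalSign` grows, and the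
  -- two cancel.
  signedDet-last : ∀ {n} (A : Matrix (suc n)) → (∀ j → A zero (inject₁ j) ≈ 0#) →
      A zero (fromℕ n) ≈ 1# →
    signedDet A ≈ signedDet (λ i j → A (suc i) (inject₁ j))
  signedDet-last {n} A A₀≈0 A₀≈1 = begin
    s * κ * det A                              ≈⟨ *-congˡ (det-last A A₀≈0) ⟩
    s * κ * (s * A zero (fromℕ n) * d)         ≈⟨ *-congˡ (*-congʳ (*-congˡ A₀≈1)) ⟩
    s * κ * (s * 1# * d)
        ≈⟨ solve 3 (λ s κ d → s :* κ :* (s :* :1 :* d) := s :* s :* (κ :* d)) refl s κ d ⟩
    s * s * (κ * d)                            ≈⟨ *-congʳ ss≈1 ⟩
    1# * (κ * d)                               ≈⟨ *-identityˡ _ ⟩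
    κ * d                                      ∎
    where
    open ≈-Reasoning
    s κ d : Carrier
    s = (- 1#) ^ n
    κ = reversalSign n
    d = det (λ i j → A (suc i) (inject₁ j))
    ss≈1 : s * s ≈ 1#
    ss≈1 = trans (sym (^-distrib-* (- 1#) (- 1#) n))
      (trans (^-congˡ n (solve 0 ((:- :1) :* (:- :1) := :1) refl)) (1^ n))

  -- Only the sums of the first point and the nodes have to be positive. So the recursive call may
  -- take all nodes zero: its first point is positive, and the next shift makes the nodes positive
  -- again.
  newton-positive : ∀ {n} (a : ℕ → Carrier) (x : Fin (suc n) → Carrier) →
    (∀ l → 0# < x zero + a l) → (∀ i j → i Fin.< j → x i < x j) →
    ∀ k → Decreasing k → k (fromℕ n) ≡ 0 → 0# < signedDet (λ i j → newton a (k j) (x i))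
  newton-positive {n} a x 0<x₀+a x↑ k k↓ k₀ = <-respʳ-≈
    (signedDet-cong λ i j → trans
      (reflexive (mixed-newton b (y i) (decreasing⇒≤first k k↓ j)))
      (newton-cong (k j) λ l → solve 3 (λ x x₀ a → x :- x₀ :+ (x₀ :+ a) := x :+ a) refl (x i)
          (x zero) (a l)))
    -- `k zero` is the largest degree, so with that many nodes every mixed polynomial is a full
    -- Newton polynomial.
    (positive-all y b 0<x₀+a (monomials n y y₀ y↑) (k zero) k k↓ k₀)
    where
    y : Fin (suc n) → Carrier
    y i = x i - x zero
    b : ℕ → Carrier
    b l = x zero + a l
    y₀ : y zero ≈ 0#
    y₀ = -‿inverseʳ (x zero)
    y↑ : ∀ i j → i Fin.< j → y i < y j
    y↑ i j i<j = 0<-⇒< (solve 3 (λ x x′ x₀ → x′ :- x₀ :- (x :- x₀) := x′ :- x) refl (x i) (x j)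
        (x zero))
      (<⇒0<- (x↑ i j i<j))
    monomials : ∀ n (y : Fin (suc n) → Carrier) → y zero ≈ 0# → (∀ i j → i Fin.< j → y i < y j) →
      Positive y b 0<x₀+a (λ _ → 0)
    monomials n y y₀ y↑ k k↓ k₀ = <-respʳ-≈
      (sym (signedDet-last A
        (λ j → first-row j (k (inject₁ j)) ≡.refl)
        (reflexive (≡.cong (λ l → mixed b 0 l (y zero)) k₀))))
      (rest n y y₀ y↑ k k↓)
      where
      A : Matrix (suc n)
      A = mixedMatrix y b 0<x₀+a (λ _ → 0) k
      first-row : ∀ j m → k (inject₁ j) ≡ m → mixed b 0 m (y zero) ≈ 0#
      first-row j zero    eq = contradiction (≡.subst (k (suc j) ℕ.<_) eq (k↓ j)) λ ()
      first-row j (suc m) eq = trans (*-congʳ y₀) (zeroˡ _)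
      -- Taking out of each row its point to the power `e`, the smallest remaining degree, brings
      -- the last degree back to zero, as the recursive call requires.
      rest : ∀ n (y : Fin (suc n) → Carrier) → y zero ≈ 0# → (∀ i j → i Fin.< j → y i < y j) →
        ∀ k → Decreasing k → 0# < signedDet (λ i j → mixed b 0 (k (inject₁ j)) (y (suc i)))
      rest zero    y y₀ y↑ k k↓ = <-respʳ-≈ (sym (*-identityˡ 1#)) 0<1
      rest (suc n) y y₀ y↑ k k↓ = <-respʳ-≈
        (trans (sym (signedDet-rows (λ i → y (suc i) ^ e)
            (λ i j → newton (λ _ → 0#) (k′ j) (y (suc i)))))
          (signedDet-cong λ i j → sym (factor j (y (suc i)))))
        (*-pos (product-pos _ λ i → ^-pos (0<y i) e)
          (newton-positive (λ _ → 0#) (y ∘ suc)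
            (λ _ → <-respʳ-≈ (sym (+-identityʳ _)) (0<y zero))
            (λ i j i<j → y↑ (suc i) (suc j) (ℕ.s≤s i<j))
            k′ k′↓ (ℕ.n∸n≡0 e)))
        where
        e : ℕ
        e = k (inject₁ (fromℕ n))
        k′ : Fin (suc n) → ℕ
        k′ j = k (inject₁ j) ℕ.∸ e
        e≤ : ∀ j → e ℕ.≤ k (inject₁ j)
        e≤ = decreasing⇒last≤ (k ∘ inject₁) (k↓ ∘ inject₁)
        k′↓ : Decreasing k′
        k′↓ i = ℕ.∸-monoˡ-< (k↓ (inject₁ i)) (e≤ (suc i))
        0<y : ∀ i → 0# < y (suc i)
        0<y i = <-respˡ-≈ y₀ (y↑ zero (suc i) (ℕ.s≤s ℕ.z≤n))
        factor : ∀ j z → mixed b 0 (k (inject₁ j)) z ≈ z ^ e * newton (λ _ → 0#) (k′ j) z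
        factor j z = begin
          mixed b 0 (k (inject₁ j)) z          ≡⟨ mixed-0 b (k (inject₁ j)) z ⟩
          z ^ k (inject₁ j)                    ≡⟨ ≡.cong (z ^_) (ℕ.m+[n∸m]≡n (e≤ j)) ⟨
          z ^ (e ℕ.+ k′ j)                     ≈⟨ ^-homo-* z e (k′ j) ⟩
          z ^ e * z ^ k′ j                     ≈⟨ *-congˡ (newton-0 (k′ j) z) ⟨
          z ^ e * newton (λ _ → 0#) (k′ j) z   ∎
          where open ≈-Reasoning

-- Pochhammer products and their powers as Newton polynomials

module NewtonPochhammer {c ℓ₁ ℓ₂ ℓ₃} (ℝ : RealNumbers c ℓ₁ ℓ₂ ℓ₃) where

  open GammaFunction ℝ
  open NewtonPositivity ℝ

  newton-≡ : ∀ {a b} k x → (∀ l → a l ≡ b l) → newton a k x ≈ newton b k x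
  newton-≡ k x a≡b = newton-cong k (λ l → +-congˡ (reflexive (a≡b l)))

  newton-+ : ∀ a m k x → newton a (m ℕ.+ k) x ≈ newton a m x * newton (λ l → a (m ℕ.+ l)) k x
  newton-+ a zero    k x = sym (*-identityˡ _)
  newton-+ a (suc m) k x = trans (*-congˡ (newton-+ (a ∘ suc) m k x)) (sym (*-assoc _ _ _))

  newton-const : ∀ a m x z → (∀ l → l ℕ.< m → a l ≈ z) → newton a m x ≈ (x + z) ^ m
  newton-const a zero    x z _   = refl
  newton-const a (suc m) x z a≈z = *-cong (+-congˡ (a≈z 0 (ℕ.s≤s ℕ.z≤n)))
    (newton-const (a ∘ suc) m x z (λ l l<m → a≈z (suc l) (ℕ.s≤s l<m)))

  -- The first `m` indices have quotient 0 and contribute (x + a 0)^m; adding `m` to an index raises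
  -- its quotient by one, which shifts the nodes.
  newton-repeat : ∀ m .{{_ : NonZero m}} a d x →
    newton (λ l → a (l / m)) (d ℕ.* m) x ≈ newton a d x ^ m
  newton-repeat m a zero    x = sym (1^ m)
  newton-repeat m a (suc d) x = begin
    newton (λ l → a (l / m)) (m ℕ.+ d ℕ.* m) x
      ≈⟨ newton-+ _ m (d ℕ.* m) x ⟩
    newton (λ l → a (l / m)) m x * newton (λ l → a ((m ℕ.+ l) / m)) (d ℕ.* m) x
      ≈⟨ *-cong
           (newton-const _ m x (a 0) λ l l<m → reflexive (≡.cong a (m<n⇒m/n≡0 l<m)))
           (trans (newton-≡ (d ℕ.* m) x λ l → ≡.cong a (≡.trans (m/n≡1+[m∸n]/n (ℕ.m≤m+n m l))
                     (≡.cong (λ j → suc (j / m)) (ℕ.m+n∸m≡n m l))))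
                  (newton-repeat m (a ∘ suc) d x)) ⟩
    (x + a 0) ^ m * newton (a ∘ suc) d x ^ m
      ≈⟨ ^-distrib-* (x + a 0) _ m ⟨
    newton a (suc d) x ^ m ∎
    where open ≈-Reasoning

  -- The Newton product starts with the largest factor, in which `poch` ends; hence the reversed
  -- index. Counted from the top, the nodes can be shared by products of different lengths.
  newton-poch : ∀ a k x z → (∀ l → l ℕ.< k → a l ≈ z + ι (k ℕ.∸ suc l)) →
      newton a k x ≈ poch (x + z) k
  newton-poch a zero    x z _  = refl
  newton-poch a (suc k) x z a≈ = trans
    (*-cong (trans (+-congˡ (a≈ 0 (ℕ.s≤s ℕ.z≤n))) (sym (+-assoc x z (ι k))))
            (newton-poch (a ∘ suc) k x z (λ l l<k → a≈ (suc l) (ℕ.s≤s l<k))))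
    (*-comm _ _)

-- The reciprocal gamma and beta matrices

module GammaMatrices {c ℓ₁ ℓ₂ ℓ₃} (ℝ : RealNumbers c ℓ₁ ℓ₂ ℓ₃) where

  open GammaFunction ℝ
  open Determinant ℝ
  open NewtonPositivity ℝ
  open NewtonPochhammer ℝ

  ι-cancel-< : ∀ {m n} → ι m < ι n → m ℕ.< n
  ι-cancel-< ιm<ιn = ℕ.≰⇒> λ n≤m → ι-mono-≤ n≤m ιm<ιn

  ι-∸ : ∀ {m n} → n ℕ.≤ m → ι (m ℕ.∸ n) ≈ ι m - ι n
  ι-∸ {m} {n} n≤m = trans
    (solve 2 (λ a b → b := a :+ b :- a) refl (ι n) (ι (m ℕ.∸ n)))
    (+-congʳ (trans (sym (ι-+ n (m ℕ.∸ n))) (reflexive (≡.cong ι (ℕ.m+[n∸m]≡n n≤m)))))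

  #0-product : ∀ {n} (r : Vector Carrier n) → (∀ i → r i # 0#) → Product.sum r # 0#
  #0-product {zero}  r r#0 = 1#0
  #0-product {suc n} r r#0 = x#0y#0→xy#0 (r#0 zero) (#0-product (r ∘ suc) (r#0 ∘ suc))

  nonsingular-scale : ∀ {n} (A B : Matrix n) (r s : Vector Carrier n) →
    (∀ i → r i # 0#) → (∀ j → s j # 0#) → (∀ i j → A i j ≈ r i * (s j * B i j)) →
    det B # 0# → det A # 0#
  nonsingular-scale A B r s r#0 s#0 A≈ B#0 = #-congʳ
    (sym (trans (det-cong A≈) (det-scale r s B)))
    (x#0y#0→xy#0 (x#0y#0→xy#0 (#0-product r r#0) (#0-product s s#0)) B#0)

  -- The inverses in the entries depend on the proof that `Γ` is apart from zero, so that proof is a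
  -- parameter.
  module _ (Γ : ∀ x → 0# < x → Carrier) (isGamma : IsGamma Γ)
    (Γ#0 : ∀ x (0<x : 0# < x) → Γ x 0<x # 0#) where

    open Gamma Γ isGamma hiding (Γ#0)

    abstract
      1/Γ : ∀ x → 0# < x → Carrier
      1/Γ x 0<x = 1/ Γ x 0<x ⟨ Γ#0 x 0<x ⟩

      1/Γ-inverseˡ : ∀ x 0<x → 1/Γ x 0<x * Γ x 0<x ≈ 1#
      1/Γ-inverseˡ x 0<x = 1/-inverseˡ (Γ#0 x 0<x)

      1/Γ-unique : ∀ {x y} 0<x → Γ x 0<x * y ≈ 1# → y ≈ 1/Γ x 0<x
      1/Γ-unique 0<x = 1/-unique (Γ#0 _ 0<x)

      1/Γ#0 : ∀ x 0<x → 1/Γ x 0<x # 0#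
      1/Γ#0 x 0<x = 0<⇒#0 (1/-pos (Γ#0 x 0<x) (Γ-pos x 0<x))

      1/Γ^ : ∀ x 0<x m → 1/ Γ x 0<x ^ m ⟨ ^-#0 (Γ#0 x 0<x) m ⟩ ≈ 1/Γ x 0<x ^ m
      1/Γ^ x 0<x m = sym (1/-unique (^-#0 (Γ#0 x 0<x) m)
          (trans (sym (^-distrib-* (Γ x 0<x) (1/Γ x 0<x) m))
        (trans (^-congˡ m (1/-inverseʳ (Γ#0 x 0<x))) (1^ m))))

      β≈ : ∀ x y 0<x 0<y →
        Beta.β Γ Γ#0 x y 0<x 0<y ≈ Γ x 0<x * (Γ y 0<y * 1/Γ (x + y) (+-pos 0<x 0<y))
      β≈ x y 0<x 0<y = *-assoc (Γ x 0<x) (Γ y 0<y) (1/Γ (x + y) (+-pos 0<x 0<y))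

    1/Γ-+ι : ∀ {x y} 0<x 0<y k → y ≈ x + ι k → 1/Γ x 0<x ≈ 1/Γ y 0<y * poch x k
    1/Γ-+ι {x} {y} 0<x 0<y k y≈x+k = sym (1/Γ-unique 0<x (begin
      Γ x 0<x * (1/Γ y 0<y * poch x k)
        ≈⟨ solve 3 (λ g i p → g :* (i :* p) := i :* (p :* g)) refl (Γ x 0<x) (1/Γ y 0<y)
            (poch x k) ⟩
      1/Γ y 0<y * (poch x k * Γ x 0<x)
        ≈⟨ *-congˡ (trans (Γ-cong y≈x+k 0<y (0<x+ι 0<x k)) (Γ-+ι 0<x k (0<x+ι 0<x k))) ⟨
      1/Γ y 0<y * Γ y 0<y
        ≈⟨ 1/Γ-inverseˡ y 0<y ⟩
      1# ∎))
      where open ≈-Reasoning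

    module _ (m : ℕ) .{{_ : NonZero m}} {n : ℕ} (lam mu : Fin (suc n) → Carrier)
      (0<lam : ∀ i → 0# < lam i) (lam↑ : ∀ i j → i Fin.< j → lam i < lam j)
      (0<mu : ∀ i → 0# < mu i) (mu↑ : ∀ i j → i Fin.< j → mu i < mu j)
      (gap : ∀ i j → toℕ j ≡ suc (toℕ i) → ∃[ d ] NonZero d × mu j - mu i ≈ ι d)
      where

      top : Carrier
      top = mu (fromℕ n)

      gap-to-top : ∀ j → ∃[ d ] (top - mu j ≈ ι d)
      gap-to-top = >-weakInduction (λ j → ∃[ d ] (top - mu j ≈ ι d)) (0 , -‿inverseʳ top)
          λ j (d , top-mu≈d) →
        let e , _ , mu-mu≈e = gap (inject₁ j) (suc j) (≡.cong suc (≡.sym (Fin.toℕ-inject₁ j)))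
        in d ℕ.+ e , trans
             (solve 3 (λ t a b → t :- a := t :- b :+ (b :- a)) refl top (mu (inject₁ j))
                 (mu (suc j)))
             (trans (+-cong top-mu≈d mu-mu≈e) (sym (ι-+ d e)))

      d : Fin (suc n) → ℕ
      d j = proj₁ (gap-to-top j)

      top≈ : ∀ j → top ≈ mu j + ι (d j)
      top≈ j = trans (solve 2 (λ t a → t := a :+ (t :- a)) refl top (mu j))
          (+-congˡ (proj₂ (gap-to-top j)))

      d↓ : Decreasing d
      d↓ i = ι-cancel-< (<-resp (proj₂ (gap-to-top (suc i))) (proj₂ (gap-to-top (inject₁ i)))
        (0<-⇒< (solve 3 (λ t a b → t :- a :- (t :- b) := b :- a) refl top (mu (inject₁ i))
            (mu (suc i)))
          (<⇒0<- (mu↑ (inject₁ i) (suc i) (ℕ.s≤s (ℕ.≤-reflexive (Fin.toℕ-inject₁ i)))))))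

      d-last : d (fromℕ n) ≡ 0
      d-last = ι≈0 (d (fromℕ n)) (trans (sym (proj₂ (gap-to-top (fromℕ n)))) (-‿inverseʳ top))
        where
        ι≈0 : ∀ k → ι k ≈ 0# → k ≡ 0
        ι≈0 zero    _    = ≡.refl
        ι≈0 (suc k) ιk≈0 = contradiction (0<ι-suc k) (≤-reflexive ιk≈0)

      -- top - (l + 1); the truncated subtraction keeps it positive for all l.
      node : ℕ → Carrier
      node l = mu zero + ι (d zero ℕ.∸ suc l)

      -- Both sides are top - (l + 1) as long as l < d j, so a single sequence of nodes serves every
      -- column.
      node≈ : ∀ j l → l ℕ.< d j → node l ≈ mu j + ι (d j ℕ.∸ suc l)
      node≈ j l l<d = begin
        mu zero + ι (d zero ℕ.∸ suc l)
            ≈⟨ +-congˡ (ι-∸ (ℕ.≤-trans l<d (decreasing⇒≤first d d↓ j))) ⟩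
        mu zero + (ι (d zero) - ι (suc l))   ≈⟨ +-assoc _ _ _ ⟨
        mu zero + ι (d zero) - ι (suc l)     ≈⟨ +-congʳ (trans (sym (top≈ zero)) (top≈ j)) ⟩
        mu j + ι (d j) - ι (suc l)           ≈⟨ +-assoc _ _ _ ⟩
        mu j + (ι (d j) - ι (suc l))         ≈⟨ +-congˡ (ι-∸ l<d) ⟨
        mu j + ι (d j ℕ.∸ suc l)             ∎
        where open ≈-Reasoning

      0<node : ∀ l → 0# < node l
      0<node l = 0<x+ι (0<mu zero) (d zero ℕ.∸ suc l)

      0<lam+mu : ∀ i j → 0# < lam i + mu j
      0<lam+mu i j = +-pos (0<lam i) (0<mu j)

      N : Matrix (suc n)
      N i j = newton (λ l → node (l / m)) (d j ℕ.* m) (lam i)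

      N-nonsingular : det N # 0#
      -- Positivity is known for the determinant times its reversal sign; a factor of a product
      -- apart from zero is apart from zero.
      N-nonsingular = xy#0⇒x#0 (#-congʳ (*-comm _ _) (0<⇒#0 (newton-positive
        (λ l → node (l / m)) lam (λ l → +-pos (0<lam zero) (0<node (l / m))) lam↑ (λ j → d j ℕ.* m)
        (λ i → ℕ.*-monoˡ-< m (d↓ i)) (≡.cong (ℕ._* m) d-last))))

      1/Γ-matrix≈ : ∀ i j → 1/Γ (lam i + mu j) (0<lam+mu i j) ^ m
                          ≈ 1/Γ (lam i + top) (0<lam+mu i (fromℕ n)) ^ m * (1# * N i j)
      1/Γ-matrix≈ i j = begin
        1/Γ (lam i + mu j) (0<lam+mu i j) ^ m   ≈⟨ ^-congˡ m shift ⟩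
        (g * p) ^ m                             ≈⟨ ^-distrib-* g p m ⟩
        g ^ m * p ^ m
            ≈⟨ *-congˡ (^-congˡ m (newton-poch node (d j) (lam i) (mu j) (node≈ j))) ⟨
        g ^ m * newton node (d j) (lam i) ^ m   ≈⟨ *-congˡ (newton-repeat m node (d j) (lam i)) ⟨
        g ^ m * N i j                           ≈⟨ *-congˡ (*-identityˡ (N i j)) ⟨
        g ^ m * (1# * N i j)                    ∎
        where
        open ≈-Reasoning
        g p : Carrier
        g = 1/Γ (lam i + top) (0<lam+mu i (fromℕ n))
        p = poch (lam i + mu j) (d j)
        shift : 1/Γ (lam i + mu j) (0<lam+mu i j) ≈ g * p
        shift = 1/Γ-+ι (0<lam+mu i j) (0<lam+mu i (fromℕ n)) (d j)
          (trans (+-congˡ (top≈ j)) (sym (+-assoc (lam i) (mu j) (ι (d j)))))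

      -- The scaling argument handles powers of inverses, the theorem speaks of inverses of powers;
      -- `1/Γ^` identifies the two.
      1/Γ-matrix 1/Γ^-matrix β-matrix : Matrix (suc n)
      1/Γ-matrix i j = 1/Γ (lam i + mu j) (0<lam+mu i j) ^ m
      1/Γ^-matrix i j = 1/ Γ (lam i + mu j) (0<lam+mu i j) ^ m ⟨ ^-#0 (Γ#0 _ _) m ⟩
      β-matrix i j = Beta.β Γ Γ#0 (lam i) (mu j) (0<lam i) (0<mu j) ^ m

      1/Γ-nonsingular : det 1/Γ-matrix # 0#
      1/Γ-nonsingular = nonsingular-scale 1/Γ-matrix N
        (λ i → 1/Γ (lam i + top) (0<lam+mu i (fromℕ n)) ^ m) (λ _ → 1#)
        (λ i → ^-#0 (1/Γ#0 (lam i + top) (0<lam+mu i (fromℕ n))) m)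
            (λ _ → 1#0) 1/Γ-matrix≈ N-nonsingular

      1/Γ^-nonsingular : det 1/Γ^-matrix # 0#
      1/Γ^-nonsingular = #-congʳ
        (det-cong {A = 1/Γ-matrix} {1/Γ^-matrix} λ i j → sym (1/Γ^ (lam i + mu j) (0<lam+mu i j) m))
        1/Γ-nonsingular

      -- Each entry is that of `1/Γ-matrix` times a row factor Γ(λᵢ)ᵐ and a column factor Γ(μⱼ)ᵐ,
      -- both apart from zero.
      β-nonsingular : det β-matrix # 0#
      β-nonsingular = nonsingular-scale β-matrix 1/Γ-matrix
        (λ i → Γ (lam i) (0<lam i) ^ m) (λ j → Γ (mu j) (0<mu j) ^ m)
        (λ i → ^-#0 (Γ#0 (lam i) (0<lam i)) m) (λ j → ^-#0 (Γ#0 (mu j) (0<mu j)) m)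
        (λ i j → trans (^-congˡ m (β≈ (lam i) (mu j) (0<lam i) (0<mu j)))
          (trans (^-distrib-* (Γ (lam i) (0<lam i))
              (Γ (mu j) (0<mu j) * 1/Γ (lam i + mu j) (0<lam+mu i j)) m)
            (*-congˡ (^-distrib-* (Γ (mu j) (0<mu j)) (1/Γ (lam i + mu j) (0<lam+mu i j)) m))))
        1/Γ-nonsingular

theorem3p1 : ∀ {c ℓ₁ ℓ₂ ℓ₃} (ℝ : RealNumbers c ℓ₁ ℓ₂ ℓ₃) → let open RealAnalysis ℝ in
    (Γ : ∀ x → 0# < x → Carrier) → IsGamma Γ →
    (m n : ℕ) → .{{_ : NonZero m}} → .{{_ : NonZero n}} →
    (lam mu : Fin n → Carrier) →
    (0<lam : ∀ i → 0# < lam i) → (∀ i j → i Fin.< j → lam i < lam j) →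
    (0<mu : ∀ i → 0# < mu i) → (∀ i j → i Fin.< j → mu i < mu j) →
    (∀ i j → toℕ j ≡ suc (toℕ i) → ∃[ d ] NonZero d × mu j - mu i ≈ ι d) →
    Σ[ Γ#0 ∈ (∀ x (0<x : 0# < x) → Γ x 0<x # 0#) ]
    Nonsingular (λ i j → 1/ Γ (lam i + mu j) (+-pos (0<lam i) (0<mu j)) ^ m ⟨ ^-#0 (Γ#0 _ _) m ⟩) ×
    Nonsingular (λ i j → Beta.β Γ Γ#0 (lam i) (mu j) (0<lam i) (0<mu j) ^ m)
theorem3p1 ℝ Γ isGamma m (suc n) lam mu 0<lam lam↑ 0<mu mu↑ gap =
  Γ#0 ,
  1/Γ^-nonsingular Γ isGamma Γ#0 m lam mu 0<lam lam↑ 0<mu mu↑ gap ,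
  β-nonsingular Γ isGamma Γ#0 m lam mu 0<lam lam↑ 0<mu mu↑ gap
  where
  open GammaMatrices ℝ
  open GammaFunction.Gamma ℝ Γ isGamma using (Γ#0)
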